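{- The single-row edge-matching problem with the free border rule in which both swaps and rotations are allowed is fixed-parameter tractable with respect to the number $K$ of colors. That is, there are a computable function $f$ and a polynomial $p$ such that, given $M$ pieces whose edges are colored with $K$ colors, it can be decided in time at most $f(K)\cdot p(n)$, where $n$ is the size of the input, whether the $M$ pieces can be placed in the cells of a $1\times M$ board in some order, each rotated by some multiple of $90^\circ$, such that every two horizontally adjacent pieces have the same color on their touching edges.
   Context: A piece is a unit square whose four edges are colored; it is given by a tuple $(c_r,c_t,c_l,c_b)$ of the colors on its right, top, left and bottom edges, in this (counter-clockwise) order. Swaps: any two pieces may interchange their positions without being rotated. Rotations: each piece may be rotated in place counter-clockwise by $0^\circ$, $90^\circ$, $180^\circ$ or $270^\circ$, i.e. its color tuple is cyclically shifted. Free border rule: edges facing the border of the board (in a single row: all top and bottom edges, the left edge of the leftmost piece and the right edge of the rightmost piece) are unrestricted. -}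

module Defs where

open import Data.Bool.Base using (Bool; true; false)
open import Data.Fin.Base using (Fin; zero; toℕ)
open import Data.Fin.Permutation using (Permutation′; _⟨$⟩ʳ_)
open import Data.List.Base using (List; []; _∷_; map; foldr)
open import Data.Nat.Base using (ℕ; zero; suc; _+_; _*_; _≤_)
open import Data.Nat.Binary.Base using (ℕᵇ; zero; 2[1+_]; 1+[2_]; fromℕ)
open import Data.Nat.GeneralisedArithmetic using (iterate)
open import Data.Product.Base using (Σ; _×_; ∃-syntax)
open import Data.Vec.Base using (Vec; _∷_; lookup; replicate; head; toList; _[_]≔_)
open import Relation.Binary.PropositionalEquality using (_≡_)
open import Relation.Nullary.Reflects using (Reflects)

------------------------------------------------------------------------
-- Model of computation: the language WHILE (N. D. Jones, "Computability
-- and Complexity from a Programming Perspective").  Data are binary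
-- trees, and each elementary operation costs one step.  Implemented with
-- shared pointers every operation takes constant time, so running times
-- agree with those of Turing machines up to a polynomial.

infixr 5 _∙_

data Tree : Set where
  nil : Tree
  _∙_ : Tree → Tree → Tree

size : Tree → ℕ
size nil     = 1
size (a ∙ b) = suc (size a + size b)

hd tl : Tree → Tree
hd nil     = nil
hd (a ∙ b) = a
tl nil     = nil
tl (a ∙ b) = b

-- The index is the number of variables of the program.
data Expr (v : ℕ) : Set where
  var   : Fin v → Expr v
  NIL   : Expr v
  CONS  : Expr v → Expr v → Expr v
  HD TL : Expr v → Expr v

infix  6 _:=_
infix  5 WHILE_DO_ IF_THEN_ELSE_
infixr 4 _⨾_

data Command (v : ℕ) : Set where
  _:=_          : Fin v → Expr v → Command v
  _⨾_           : Command v → Command v → Command v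
  IF_THEN_ELSE_ : Expr v → Command v → Command v → Command v
  WHILE_DO_     : Expr v → Command v → Command v

Store : ℕ → Set
Store v = Vec Tree v

eval : ∀ {v} → Expr v → Store v → Tree
eval (var x)    σ = lookup σ x
eval NIL        σ = nil
eval (CONS e f) σ = eval e σ ∙ eval f σ
eval (HD e)     σ = hd (eval e σ)
eval (TL e)     σ = tl (eval e σ)

cost : ∀ {v} → Expr v → ℕ
cost (var x)    = 1
cost NIL        = 1
cost (CONS e f) = suc (cost e + cost f)
cost (HD e)     = suc (cost e)
cost (TL e)     = suc (cost e)

-- Exec c σ σ′ t: started in the store σ, the command c halts after t
-- steps in the store σ′.  Tests treat nil as false and all other trees
-- as true.
data Exec {v : ℕ} : Command v → Store v → Store v → ℕ → Set where
  assign : ∀ {x e σ} →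
           Exec (x := e) σ (σ [ x ]≔ eval e σ) (suc (cost e))
  seq    : ∀ {c d σ σ′ σ″ s t} →
           Exec c σ σ′ s → Exec d σ′ σ″ t →
           Exec (c ⨾ d) σ σ″ (s + t)
  if-true  : ∀ {e c d σ σ′ a b t} → eval e σ ≡ a ∙ b →
             Exec c σ σ′ t →
             Exec (IF e THEN c ELSE d) σ σ′ (suc (cost e) + t)
  if-false : ∀ {e c d σ σ′ t} → eval e σ ≡ nil →
             Exec d σ σ′ t →
             Exec (IF e THEN c ELSE d) σ σ′ (suc (cost e) + t)
  while-true  : ∀ {e c σ σ′ σ″ a b s t} → eval e σ ≡ a ∙ b →
                Exec c σ σ′ s → Exec (WHILE e DO c) σ′ σ″ t →
                Exec (WHILE e DO c) σ σ″ (suc (cost e) + (s + t))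
  while-false : ∀ {e c σ} → eval e σ ≡ nil →
                Exec (WHILE e DO c) σ σ (suc (cost e))

-- Variable 0 holds the input and, at the end, the output; the auxiliary
-- variables are initially nil.
record Program : Set where
  constructor program
  field
    auxiliaries : ℕ
    body        : Command (suc auxiliaries)

Runs : Program → Tree → Tree → ℕ → Set
Runs (program v c) input output t =
  ∃[ σ ] Exec c (input ∷ replicate v nil) σ t × head σ ≡ output

------------------------------------------------------------------------
-- Encodings

listTree : List Tree → Tree
listTree = foldr _∙_ nil

unaryTree : ℕ → Tree
unaryTree zero    = nil
unaryTree (suc n) = nil ∙ unaryTree n

bitsTree : ℕᵇ → Tree
bitsTree zero     = nil
bitsTree 2[1+ x ] = nil ∙ bitsTree x
bitsTree 1+[2 x ] = (nil ∙ nil) ∙ bitsTree x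

binaryTree : ℕ → Tree
binaryTree n = bitsTree (fromℕ n)

boolTree : Bool → Tree
boolTree false = nil
boolTree true  = nil ∙ nil

------------------------------------------------------------------------
-- Fixed-parameter tractability

Computable : (ℕ → ℕ) → Set
Computable f =
  ∃[ P ] (∀ k → ∃[ t ] Runs P (unaryTree k) (unaryTree (f k)) t)

-- The list a₀ ∷ a₁ ∷ … of coefficients stands for a₀ + a₁ n + ….
Polynomial : Set
Polynomial = List ℕ

evalPoly : Polynomial → ℕ → ℕ
evalPoly p n = foldr (λ a r → a + n * r) 0 p

record ParameterizedProblem : Set₁ where
  field
    Instance  : Set
    encode    : Instance → Tree
    parameter : Instance → ℕ
    Yes       : Instance → Set

DecidesWithin : (Π : ParameterizedProblem) → Program →
                (ParameterizedProblem.Instance Π → ℕ) → Set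
DecidesWithin Π P bound =
  ∀ x → ∃[ b ] ∃[ t ]
    Runs P (encode x) (boolTree b) t × t ≤ bound x × Reflects (Yes x) b
  where open ParameterizedProblem Π

FixedParameterTractable : ParameterizedProblem → Set
FixedParameterTractable Π =
  ∃[ f ] ∃[ p ] ∃[ P ]
    Computable f ×
    DecidesWithin Π P (λ x → f (parameter x) * evalPoly p (size (encode x)))
  where open ParameterizedProblem Π

------------------------------------------------------------------------
-- Edge matching

record Piece (K : ℕ) : Set where
  constructor piece
  field
    right top left bottom : Fin K

open Piece public

-- Counter-clockwise by 90°: the old right edge becomes the top edge.
rotate90 : ∀ {K} → Piece K → Piece K
rotate90 (piece r t l b) = piece b r t l

rotate : ∀ {K} → Fin 4 → Piece K → Piece K
rotate q x = iterate rotate90 x (toℕ q)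

record PieceSet : Set where
  constructor pieceSet
  field
    K      : ℕ
    M      : ℕ
    pieces : Vec (Piece K) M

-- Cell i, counted from the left, holds the piece with index π i, turned by
-- ρ i quarter turns.  Edges facing the border are unrestricted.
Placeable : PieceSet → Set
Placeable (pieceSet K M pieces) =
  Σ (Permutation′ M) λ π → Σ (Fin M → Fin 4) λ ρ →
    let placed = λ i → rotate (ρ i) (lookup pieces (π ⟨$⟩ʳ i)) in
    ∀ i j → toℕ j ≡ suc (toℕ i) → right (placed i) ≡ left (placed j)

colorTree : ∀ {K} → Fin K → Tree
colorTree c = binaryTree (toℕ c)

pieceTree : ∀ {K} → Piece K → Tree
pieceTree (piece r t l b) =
  listTree (colorTree r ∷ colorTree t ∷ colorTree l ∷ colorTree b ∷ [])

pieceSetTree : PieceSet → Tree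
pieceSetTree (pieceSet K M pieces) =
  binaryTree K ∙ listTree (map pieceTree (toList pieces))

singleRowSwapsRotations : ParameterizedProblem
singleRowSwapsRotations = record
  { Instance  = PieceSet
  ; encode    = pieceSetTree
  ; parameter = PieceSet.K
  ; Yes       = Placeable
  }

{-# OPTIONS --safe #-}

-- A piece offers two edges of a multigraph on the K colors, namely its pairs
-- of opposite sides, and a row is a trail that uses one edge of each piece.
-- If a row contains five copies of a piece, two of them are turned alike, and
-- both can be dropped when the segment between them is reversed.  Conversely,
-- next to a copy of a piece two more copies can be inserted.  Hence five
-- copies may be replaced by three, and at most four copies of each of the K⁴
-- possible pieces remain, on which an exhaustive search is run.
--
-- Programs are written in a language of functions on trees whose only loops
-- are left folds.  Its running times, and those of the search on the kernel,
-- are dominated by functions built from the successor by composition and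
-- n ↦ gⁿ(n), which are computable and leave room for every constant.
module Submission where

open import Defs
open import Data.Bool.Base using (Bool; true; false; if_then_else_)
open import Data.Fin.Base as Fin using (Fin; zero; suc; toℕ)
open import Data.Fin.Permutation as Perm
  using (Permutation; Permutation′; _⟨$⟩ʳ_; _⟨$⟩ˡ_; _∘ₚ_; cast-id)
import Data.Fin.Properties as Fin
open import Data.List.Base as List
  using (List; []; _∷_; _++_; map; foldl; length; _ʳ++_; null; filter; cartesianProductWith; allFin)
open import Data.List.Membership.Propositional using (_∈_; find; lose)
open import Data.List.Membership.Propositional.Properties
  using (∈-∃++; ∈-++⁻; ∈-++⁺ʳ; ∈-lookup; ∈-cartesianProductWith⁺; ∈-allFin; ∈-tabulate⁺)
open import Data.List.Membership.Propositional.Properties.WithK using (unique∧set⇒bag)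
open import Data.List.Properties
  using (foldl-++; ++-identityʳ; ++-assoc; length-map; length-++; length-tabulate; map-++;
         map-tabulate; filter-++; filter-all; filter-none)
open import Data.List.Relation.Binary.BagAndSetEquality using (∼bag⇒↭)
open import Data.List.Relation.Binary.Permutation.Homogeneous using (onIndices)
open import Data.List.Relation.Binary.Permutation.Propositional
  using (_↭_; ↭-refl; ↭-sym; ↭-trans; ↭-prep; ↭-reflexive; ↭⇒↭ₛ; module PermutationReasoning)
open import Data.List.Relation.Binary.Permutation.Propositional.Properties
  using (++⁺ˡ; ++⁺ʳ; ++-comm; ++↭ʳ++; shift; drop-∷; ↭-length; ↭-empty-inv; ↭-map-inv; map⁺;
         ∈-resp-↭; filter-↭; ¬x∷xs↭[])
open import Data.List.Relation.Binary.Permutation.Setoid.Properties using (onIndices-lookup)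
open import Data.List.Relation.Unary.All as All using (All; []; _∷_)
open import Data.List.Relation.Unary.Any using (Any; here; there)
open import Data.List.Relation.Unary.Any.Properties using (reverseAcc⁺; reverseAcc⁻)
open import Data.List.Relation.Unary.Linked using (Linked; []; [-]; _∷_)
open import Data.List.Relation.Unary.Unique.Propositional.Properties using (tabulate⁺; allFin⁺)
open import Data.Maybe.Base using (Maybe; just; nothing)
open import Data.Nat.Base using (ℕ; zero; suc; _+_; _*_; _≤_; _<_; z≤n; s≤s)
open import Data.Nat.Binary.Base as ℕᵇ using (ℕᵇ; 2[1+_]; 1+[2_]; fromℕ)
open import Data.Nat.Binary.Properties using (fromℕ-injective; toℕ-fromℕ)
open import Data.Nat.GeneralisedArithmetic using (iterate) renaming (fold to foldℕ)
open import Data.Nat.Properties hiding (_≟_)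
open import Data.Nat.Tactic.RingSolver using (solve-∀)
open import Data.Product.Base using (Σ; _,_; ∃-syntax; _×_; proj₁; proj₂)
open import Data.Product.Properties using (≡-dec)
open import Data.Sum.Base using (_⊎_; inj₁; inj₂)
open import Data.Vec.Base as Vec using (Vec; []; _∷_; lookup; toList; fromList)
open import Data.Vec.Properties using (length-toList; toList-map; lookup-map; toList∘fromList)
open import Function.Base using (_∘_; id; _$′_; case_of_)
open import Function.Bundles using (_⇔_; mk⇔; Equivalence; Injection)
open import Function.Construct.Composition using (_⇔-∘_)
open import Function.Construct.Identity using (⇔-id)
open import Function.Properties.Inverse using (↔⇒↣)
open import Relation.Binary.Definitions using (DecidableEquality)
open import Relation.Binary.PropositionalEquality
  using (_≡_; _≢_; refl; sym; trans; cong; cong₂; subst; subst₂; setoid; module ≡-Reasoning)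
open import Relation.Nullary.Decidable using (Dec; does; yes; no; map′; dec-true)
open import Relation.Nullary.Negation using (contradiction)
open import Relation.Nullary.Reflects using (Reflects; ofʸ; ofⁿ)

-- A language of folds

-- The reversal rests on the half turn, which exchanges the left and right sides of a piece, so that
-- every edge of the multigraph can be traversed both ways. Five copies are asked for, although a
-- piece offers only two edges, because the two dropped copies must be turned alike: two copies of
-- one edge traversed in opposite directions enclose a closed walk, which need not touch the rest of
-- the row once they are dropped. Hence the pigeonholes are the four orientations.
--
-- The size of the encoded kernel depends on K alone, so the time of the search needs no analysis:
-- every program of folds is bounded by some growth function. The only loop over all M pieces is the
-- kernelization. There a generic bound would be far from linear, so this loop is timed by hand,
-- with the cap on multiplicities as its invariant.

-- The environment is itself a tree, so that F at G, which runs F in the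
-- environment computed by G, serves for calls and for local definitions.
data Fun : Set where
  env      : Fun
  leaf     : Fun
  cons     : Fun → Fun → Fun
  fst snd  : Fun → Fun
  cond     : Fun → Fun → Fun → Fun
  _at_     : Fun → Fun → Fun
  fold     : Fun → Fun → Fun → Fun

infixl 6 _at_

ifTree : ∀ {A : Set} → Tree → A → A → A
ifTree nil     x y = y
ifTree (_ ∙ _) x y = x

foldTree : (Tree → Tree → Tree) → Tree → Tree → Tree
foldTree f nil      a = a
foldTree f (x ∙ xs) a = foldTree f xs (f x a)

⟦_⟧ : Fun → Tree → Tree
⟦ env ⟧        ρ = ρ
⟦ leaf ⟧       ρ = nil
⟦ cons F G ⟧   ρ = ⟦ F ⟧ ρ ∙ ⟦ G ⟧ ρ
⟦ fst F ⟧      ρ = hd (⟦ F ⟧ ρ)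
⟦ snd F ⟧      ρ = tl (⟦ F ⟧ ρ)
⟦ cond F G H ⟧ ρ = ifTree (⟦ F ⟧ ρ) (⟦ G ⟧ ρ) (⟦ H ⟧ ρ)
⟦ F at G ⟧     ρ = ⟦ F ⟧ (⟦ G ⟧ ρ)
⟦ fold L A F ⟧ ρ = foldTree (λ x a → ⟦ F ⟧ (x ∙ a ∙ ρ)) (⟦ L ⟧ ρ) (⟦ A ⟧ ρ)

-- The 3 is the test of the loop; 8, 7 and 4 are the assignments that `body` puts around the
-- compiled command.
timeFold : (Tree → Tree → Tree) → (Tree → Tree → ℕ) → Tree → Tree → ℕ
timeFold f t nil      a = 3
timeFold f t (x ∙ xs) a = 3 + ((8 + (7 + (t x a + 4))) + timeFold f t xs (f x a))

-- The summands mirror the commands in compile, which makes them match the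
-- indices of Exec without arithmetic.
time : Fun → Tree → ℕ
time env          ρ = 2
time leaf         ρ = 2
time (cons F G)   ρ = time F ρ + (4 + (time G ρ + (5 + 3)))
time (fst F)      ρ = time F ρ + 3
time (snd F)      ρ = time F ρ + 3
time (cond F G H) ρ = time F ρ + (2 + ifTree (⟦ F ⟧ ρ) (time G ρ) (time H ρ))
time (F at G)     ρ = time G ρ + (4 + (2 + (time F (⟦ G ⟧ ρ) + (3 + 3))))
time (fold L A F) ρ =
  time L ρ + (4 + (time A ρ +
  (timeFold (λ x a → ⟦ F ⟧ (x ∙ a ∙ ρ)) (λ x a → time F (x ∙ a ∙ ρ)) (⟦ L ⟧ ρ) (⟦ A ⟧ ρ) + 3)))

-- Compilation to WHILE

-- The result, the environment and the stack of suspended computations.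
R E S : Fin 3
R = zero
E = suc zero
S = suc (suc zero)

-- The unread part of the list lies on top of `S`, and `R` holds the accumulator. The environment
-- grows to `x ∙ a ∙ ρ` for one iteration, and two tails restore it.
body : Command 3 → Command 3
body c =
  E := CONS (HD (HD (var S))) (CONS (var R) (var E)) ⨾
  S := CONS (TL (HD (var S))) (TL (var S)) ⨾
  c ⨾
  E := TL (TL (var E))

compile : Fun → Command 3
compile env          = R := var E
compile leaf         = R := NIL
compile (cons F G)   =
  compile F ⨾ S := CONS (var R) (var S) ⨾
  compile G ⨾ R := CONS (HD (var S)) (var R) ⨾ S := TL (var S)
compile (fst F)      = compile F ⨾ R := HD (var R)
compile (snd F)      = compile F ⨾ R := TL (var R)
compile (cond F G H) = compile F ⨾ IF var R THEN compile G ELSE compile H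
compile (F at G)     =
  compile G ⨾ S := CONS (var E) (var S) ⨾ E := var R ⨾
  compile F ⨾ E := HD (var S) ⨾ S := TL (var S)
compile (fold L A F) =
  compile L ⨾ S := CONS (var R) (var S) ⨾
  compile A ⨾ (WHILE HD (var S) DO body (compile F)) ⨾ S := TL (var S)

-- That `E` and `S` are left as they were found is what allows compiled terms to be chained. `R`
-- starts arbitrary because it still holds an earlier result.
compile-correct : ∀ F r ρ s →
  Exec (compile F) (r ∷ ρ ∷ s ∷ []) (⟦ F ⟧ ρ ∷ ρ ∷ s ∷ []) (time F ρ)
loop-correct : ∀ F ρ s xs a →
  Exec (WHILE HD (var S) DO body (compile F)) (a ∷ ρ ∷ (xs ∙ s) ∷ [])
       (foldTree (λ x a → ⟦ F ⟧ (x ∙ a ∙ ρ)) xs a ∷ ρ ∷ (nil ∙ s) ∷ [])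
       (timeFold (λ x a → ⟦ F ⟧ (x ∙ a ∙ ρ)) (λ x a → time F (x ∙ a ∙ ρ)) xs a)
compile-correct env          r ρ s = assign
compile-correct leaf         r ρ s = assign
compile-correct (cons F G)   r ρ s =
  seq (compile-correct F r ρ s) (seq assign
  (seq (compile-correct G _ ρ _) (seq assign assign)))
compile-correct (fst F)      r ρ s = seq (compile-correct F r ρ s) assign
compile-correct (snd F)      r ρ s = seq (compile-correct F r ρ s) assign
compile-correct (cond F G H) r ρ s with ⟦ F ⟧ ρ in eq | compile-correct F r ρ s
... | nil   | F-runs = seq F-runs (if-false refl (compile-correct H _ ρ s))
... | _ ∙ _ | F-runs = seq F-runs (if-true refl (compile-correct G _ ρ s))
compile-correct (F at G)     r ρ s =
  seq (compile-correct G r ρ s) (seq assign (seq assign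
  (seq (compile-correct F _ (⟦ G ⟧ ρ) _) (seq assign assign))))
compile-correct (fold L A F) r ρ s =
  seq (compile-correct L r ρ s) (seq assign
  (seq (compile-correct A _ ρ _) (seq (loop-correct F ρ s _ _) assign)))
loop-correct F ρ s nil      a = while-false refl
loop-correct F ρ s (x ∙ xs) a = while-true refl
  (seq assign (seq assign (seq (compile-correct F a (x ∙ a ∙ ρ) (xs ∙ s)) assign)))
  (loop-correct F ρ s xs (⟦ F ⟧ (x ∙ a ∙ ρ)))

toProgram : Fun → Program
toProgram F = program 2 (E := var R ⨾ compile F)

-- The 2 pays for copying the input into `E`.
runs : ∀ F x {y} → ⟦ F ⟧ x ≡ y → Runs (toProgram F) x y (2 + time F x)
runs F x Fx≡y = _ , seq assign (compile-correct F x x nil) , Fx≡y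

-- Growth functions

-- All these functions are monotone and inflationary, so bounds can be composed and rounded up
-- without side conditions.
data Growth : Set where
  increment : Growth
  _⊚_       : Growth → Growth → Growth
  iterated  : Growth → Growth

value : Growth → ℕ → ℕ
value increment    n = suc n
value (g ⊚ h)      n = value g (value h n)
value (iterated g) n = iterate (value g) n n

growthFun : Growth → Fun
growthFun increment    = cons leaf env
growthFun (g ⊚ h)      = growthFun g at growthFun h
-- A unary number is a list of `nil`s, so the argument serves both as loop counter and as initial
-- accumulator.
growthFun (iterated g) = fold env env (growthFun g at fst (snd env))

growthFun-correct : ∀ g n → ⟦ growthFun g ⟧ (unaryTree n) ≡ unaryTree (value g n)
growthFun-correct increment    n = refl
growthFun-correct (g ⊚ h)      n =
  trans (cong ⟦ growthFun g ⟧ (growthFun-correct h n)) (growthFun-correct g (value h n))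
growthFun-correct (iterated g) n = go n n
  where
  go : ∀ k m → foldTree (λ _ a → ⟦ growthFun g ⟧ a) (unaryTree k) (unaryTree m) ≡
               unaryTree (iterate (value g) m k)
  go zero    m = refl
  go (suc k) m rewrite growthFun-correct g m = go k (value g m)

value-computable : ∀ g → Computable (value g)
value-computable g =
  toProgram (growthFun g) ,
  λ k → _ , runs (growthFun g) (unaryTree k) (growthFun-correct g k)

iterate-mono : ∀ {f : ℕ → ℕ} → (∀ {m n} → m ≤ n → f m ≤ f n) →
               ∀ k {m n} → m ≤ n → iterate f m k ≤ iterate f n k
iterate-mono f-mono zero    m≤n = m≤n
iterate-mono f-mono (suc k) m≤n = iterate-mono f-mono k (f-mono m≤n)

iterate-inflationary : ∀ {f : ℕ → ℕ} → (∀ n → n ≤ f n) → ∀ k n → n ≤ iterate f n k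
iterate-inflationary n≤f zero    n = ≤-refl
iterate-inflationary n≤f (suc k) n = ≤-trans (n≤f n) (iterate-inflationary n≤f k _)

iterate-mono-count : ∀ {f : ℕ → ℕ} → (∀ n → n ≤ f n) →
                     ∀ {k l} n → k ≤ l → iterate f n k ≤ iterate f n l
iterate-mono-count n≤f {l = l} n z≤n       = iterate-inflationary n≤f l n
iterate-mono-count n≤f         n (s≤s k≤l) = iterate-mono-count n≤f _ k≤l

inflationary : ∀ g n → n ≤ value g n
inflationary increment    n = n≤1+n n
inflationary (g ⊚ h)      n = ≤-trans (inflationary h n) (inflationary g _)
inflationary (iterated g) n = iterate-inflationary (inflationary g) n n

monotone : ∀ g {m n} → m ≤ n → value g m ≤ value g n
monotone increment    m≤n = s≤s m≤n
monotone (g ⊚ h)      m≤n = monotone g (monotone h m≤n)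
monotone (iterated g) {m} {n} m≤n = ≤-trans
  (iterate-mono (monotone g) m m≤n) (iterate-mono-count (inflationary g) n m≤n)

infix 4 _≼_

_≼_ : (ℕ → ℕ) → Growth → Set
f ≼ g = ∀ n → f n ≤ value g n

Dominated : (ℕ → ℕ) → Set
Dominated f = ∃[ g ] f ≼ g

value-dominated : ∀ g → Dominated (value g)
value-dominated g = g , λ _ → ≤-refl

id-dominated : Dominated id
id-dominated = increment , n≤1+n

const-dominated : ∀ c → Dominated (λ _ → c)
const-dominated zero    = increment , λ _ → z≤n
const-dominated (suc c) with g , c≼g ← const-dominated c = increment ⊚ g , s≤s ∘ c≼g

infixr 9 _∘-dominated_
infixl 6 _+-dominated_
infixl 7 _*-dominated_

_∘-dominated_ : ∀ {f f′} → Dominated f → Dominated f′ → Dominated (f ∘ f′)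
(g , f≼g) ∘-dominated (g′ , f′≼g′) =
  g ⊚ g′ , λ n → ≤-trans (f≼g _) (monotone g (f′≼g′ n))

-- Both values are at most value (g ⊚ g′) n, so a binary operation is
-- dominated as soon as it is dominated on the diagonal.
diagonal : ∀ {f f′} (_•_ : ℕ → ℕ → ℕ) →
           (∀ {k l m n} → k ≤ l → m ≤ n → (k • m) ≤ (l • n)) → Dominated (λ n → n • n) →
           Dominated f → Dominated f′ → Dominated (λ n → f n • f′ n)
diagonal _•_ •-mono (d , •≼d) (g , f≼g) (g′ , f′≼g′) =
  d ⊚ (g ⊚ g′) , λ n → ≤-trans
    (•-mono (≤-trans (f≼g n) (monotone g (inflationary g′ n)))
            (≤-trans (f′≼g′ n) (inflationary g _)))
    (•≼d _)

doubling : Growth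
doubling = iterated increment

iterate-suc : ∀ k n → iterate suc n k ≡ k + n
iterate-suc zero    n = refl
iterate-suc (suc k) n = trans (iterate-suc k (suc n)) (+-suc k n)

double≼doubling : (λ n → n + n) ≼ doubling
double≼doubling n = ≤-reflexive (sym (iterate-suc n n))

_+-dominated_ : ∀ {f f′} → Dominated f → Dominated f′ → Dominated (λ n → f n + f′ n)
_+-dominated_ = diagonal _+_ +-mono-≤ (doubling , double≼doubling)

_*-dominated_ : ∀ {f f′} → Dominated f → Dominated f′ → Dominated (λ n → f n * f′ n)
_*-dominated_ = diagonal _*_ *-mono-≤
  -- Each of the n doublings, starting from n, adds at least n, so n + n * n is reached.
  (iterated doubling , λ n → ≤-trans (m≤n+m (n * n) n) (go n n n ≤-refl))
  where
  open ≤-Reasoning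
  go : ∀ k m n → n ≤ m → m + k * n ≤ iterate (value doubling) m k
  go zero    m n n≤m = ≤-reflexive (+-identityʳ m)
  go (suc k) m n n≤m = begin
    m + (n + k * n)                               ≡⟨ +-assoc m n (k * n) ⟨
    m + n + k * n                                 ≤⟨ +-monoˡ-≤ (k * n) (+-monoʳ-≤ m n≤m) ⟩
    m + m + k * n                                 ≤⟨ +-monoˡ-≤ (k * n) (double≼doubling m) ⟩
    value doubling m + k * n                      ≤⟨ go k _ n (≤-trans n≤m (inflationary doubling m)) ⟩
    iterate (value doubling) (value doubling m) k ∎

-- Time bounds

size-hd : ∀ x → size (hd x) ≤ size x
size-hd nil     = ≤-refl
size-hd (x ∙ y) = m≤n⇒m≤1+n (m≤m+n (size x) (size y))

size-tl : ∀ x → size (tl x) ≤ size x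
size-tl nil     = ≤-refl
size-tl (x ∙ y) = m≤n⇒m≤1+n (m≤n+m (size y) (size x))

-- Size and time are bounded together because the time of `F at G`, and of each iteration of a loop,
-- depends on the size of an earlier result.
Bounded : Fun → Set
Bounded F = ∃[ g ] ∀ ρ → size (⟦ F ⟧ ρ) ≤ value g (size ρ) × time F ρ ≤ value g (size ρ)

boundedBy : ∀ {s t} F → Dominated s → Dominated t →
            (∀ ρ → size (⟦ F ⟧ ρ) ≤ s (size ρ)) → (∀ ρ → time F ρ ≤ t (size ρ)) → Bounded F
boundedBy F s-dom t-dom size≤s time≤t with g , s+t≼g ← s-dom +-dominated t-dom =
  g , λ ρ → ≤-trans (≤-trans (size≤s ρ) (m≤m+n _ _)) (s+t≼g _) ,
            ≤-trans (≤-trans (time≤t ρ) (m≤n+m _ _)) (s+t≼g _)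

module Loop (F : Fun) (s : Growth) (ρ : Tree)
            (F-bound : ∀ x a n → size x ≤ n → size a ≤ n → size ρ ≤ n →
                       size (⟦ F ⟧ (x ∙ a ∙ ρ)) ≤ value s n × time F (x ∙ a ∙ ρ) ≤ value s n)
            where

  -- A single n bounds the list, the accumulator and the environment. An iteration turns n into
  -- `value s n`, and a list has fewer entries than its size.
  size-foldTree : ∀ xs a n → size xs ≤ n → size a ≤ n → size ρ ≤ n →
    size (foldTree (λ x a → ⟦ F ⟧ (x ∙ a ∙ ρ)) xs a) ≤ iterate (value s) n (size xs)
  size-foldTree nil      a n xs≤n a≤n ρ≤n = ≤-trans a≤n (inflationary s n)
  size-foldTree (x ∙ xs) a n xs≤n a≤n ρ≤n = ≤-trans
    (size-foldTree xs _ (value s n)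
      (≤-trans (size-tl (x ∙ xs)) (≤-trans xs≤n (inflationary s n)))
      (proj₁ (F-bound x a n (≤-trans (size-hd (x ∙ xs)) xs≤n) a≤n ρ≤n))
      (≤-trans ρ≤n (inflationary s n)))
    (iterate-mono-count (inflationary s) (value s n) (m≤n+m (size xs) (size x)))

  -- `C` dominates the bounds of all iterations at once, since iterating `s` only increases them; 22
  -- = 3 + 8 + 7 + 4 is the overhead of one iteration.
  timeFold-bound : ∀ xs a n C → size xs ≤ n → size a ≤ n → size ρ ≤ n →
    iterate (value s) n (size xs) ≤ C →
    timeFold (λ x a → ⟦ F ⟧ (x ∙ a ∙ ρ)) (λ x a → time F (x ∙ a ∙ ρ)) xs a ≤ size xs * (22 + C)
  timeFold-bound nil      a n C xs≤n a≤n ρ≤n ≤C = s≤s (s≤s (s≤s z≤n))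
  timeFold-bound (x ∙ xs) a n C xs≤n a≤n ρ≤n ≤C
    rewrite +-comm (time F (x ∙ a ∙ ρ)) 4 = +-mono-≤
      (+-monoʳ-≤ 22 (≤-trans (proj₂ Fxa) (≤-trans (iterate-inflationary (inflationary s) (size x + size xs) _) ≤C)))
      (≤-trans
        (timeFold-bound xs _ (value s n) C
          (≤-trans (size-tl (x ∙ xs)) (≤-trans xs≤n (inflationary s n)))
          (proj₁ Fxa)
          (≤-trans ρ≤n (inflationary s n))
          (≤-trans (iterate-mono-count (inflationary s) _ (m≤n+m (size xs) (size x))) ≤C))
        (*-monoˡ-≤ (22 + C) (m≤n+m (size xs) (size x))))
    where
    Fxa = F-bound x a n (≤-trans (size-hd (x ∙ xs)) xs≤n) a≤n ρ≤n

opaque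

  bounded : ∀ F → Bounded F
  bounded env = boundedBy env id-dominated (const-dominated 2) (λ _ → ≤-refl) (λ _ → ≤-refl)
  bounded leaf = boundedBy leaf (const-dominated 1) (const-dominated 2) (λ _ → ≤-refl) (λ _ → ≤-refl)
  bounded (cons F G) with g , F-bound ← bounded F | h , G-bound ← bounded G =
    boundedBy (cons F G)
      (const-dominated 1 +-dominated (value-dominated g +-dominated value-dominated h))
      (value-dominated g +-dominated (const-dominated 4 +-dominated (value-dominated h +-dominated const-dominated 8)))
      (λ ρ → s≤s (+-mono-≤ (proj₁ (F-bound ρ)) (proj₁ (G-bound ρ))))
      (λ ρ → +-mono-≤ (proj₂ (F-bound ρ)) (+-monoʳ-≤ 4 (+-monoˡ-≤ 8 (proj₂ (G-bound ρ)))))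
  bounded (fst F) with g , F-bound ← bounded F =
    boundedBy (fst F) (value-dominated g) (value-dominated g +-dominated const-dominated 3)
      (λ ρ → ≤-trans (size-hd (⟦ F ⟧ ρ)) (proj₁ (F-bound ρ)))
      (λ ρ → +-monoˡ-≤ 3 (proj₂ (F-bound ρ)))
  bounded (snd F) with g , F-bound ← bounded F =
    boundedBy (snd F) (value-dominated g) (value-dominated g +-dominated const-dominated 3)
      (λ ρ → ≤-trans (size-tl (⟦ F ⟧ ρ)) (proj₁ (F-bound ρ)))
      (λ ρ → +-monoˡ-≤ 3 (proj₂ (F-bound ρ)))
  bounded (cond F G H) with f , F-bound ← bounded F | g , G-bound ← bounded G | h , H-bound ← bounded H =
    boundedBy (cond F G H)
      (value-dominated g +-dominated value-dominated h)
      (value-dominated f +-dominated (const-dominated 2 +-dominated (value-dominated g +-dominated value-dominated h)))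
      (λ ρ → size-cond ρ (⟦ F ⟧ ρ))
      (λ ρ → +-mono-≤ (proj₂ (F-bound ρ)) (+-monoʳ-≤ 2 (time-cond ρ (⟦ F ⟧ ρ))))
    where
    size-cond : ∀ ρ b → size (ifTree b (⟦ G ⟧ ρ) (⟦ H ⟧ ρ)) ≤ value g (size ρ) + value h (size ρ)
    size-cond ρ nil     = ≤-trans (proj₁ (H-bound ρ)) (m≤n+m _ _)
    size-cond ρ (_ ∙ _) = ≤-trans (proj₁ (G-bound ρ)) (m≤m+n _ _)
    time-cond : ∀ ρ b → ifTree b (time G ρ) (time H ρ) ≤ value g (size ρ) + value h (size ρ)
    time-cond ρ nil     = ≤-trans (proj₂ (H-bound ρ)) (m≤n+m _ _)
    time-cond ρ (_ ∙ _) = ≤-trans (proj₂ (G-bound ρ)) (m≤m+n _ _)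
  bounded (F at G) with f , F-bound ← bounded F | g , G-bound ← bounded G =
    boundedBy (F at G)
      (value-dominated (f ⊚ g))
      (value-dominated g +-dominated (const-dominated 6 +-dominated (value-dominated (f ⊚ g) +-dominated const-dominated 6)))
      (λ ρ → ≤-trans (proj₁ (F-bound (⟦ G ⟧ ρ))) (monotone f (proj₁ (G-bound ρ))))
      (λ ρ → +-mono-≤ (proj₂ (G-bound ρ)) (+-monoʳ-≤ 6 (+-monoˡ-≤ 6
               (≤-trans (proj₂ (F-bound (⟦ G ⟧ ρ))) (monotone f (proj₁ (G-bound ρ)))))))
  bounded (fold L A F) with l , L-bound ← bounded L | a , A-bound ← bounded A | f , F-bound ← bounded F
    -- `s` bounds one iteration: `x ∙ b ∙ ρ` has size at most 1 + (n + (1 + (n + n))) if its three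
    -- parts have size at most n. `d` bounds list, accumulator and environment at the start; as it
    -- also bounds the number of iterations, `iterated s` is applied to it.
    with s , f∘≼s ← value-dominated f ∘-dominated
                    (const-dominated 1 +-dominated (id-dominated +-dominated
                    (const-dominated 1 +-dominated (id-dominated +-dominated id-dominated))))
    with d , start≼d ← value-dominated l +-dominated value-dominated a +-dominated id-dominated =
    boundedBy (fold L A F)
      (value-dominated (iterated s ⊚ d))
      (value-dominated l +-dominated (const-dominated 4 +-dominated (value-dominated a +-dominated
        (value-dominated d *-dominated (const-dominated 22 +-dominated value-dominated (iterated s ⊚ d))
         +-dominated const-dominated 3))))
      (λ ρ → ≤-trans
        (size-foldTree ρ (⟦ L ⟧ ρ) (⟦ A ⟧ ρ) _ (L≤d ρ) (A≤d ρ) (ρ≤d ρ))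
        (iterate-mono-count (inflationary s) _ (L≤d ρ)))
      (λ ρ → +-mono-≤ (proj₂ (L-bound ρ)) (+-monoʳ-≤ 4 (+-mono-≤ (proj₂ (A-bound ρ)) (+-monoˡ-≤ 3
        (≤-trans
          (timeFold-bound ρ (⟦ L ⟧ ρ) (⟦ A ⟧ ρ) (value d (size ρ)) (value (iterated s ⊚ d) (size ρ))
            (L≤d ρ) (A≤d ρ) (ρ≤d ρ) (iterate-mono-count (inflationary s) _ (L≤d ρ)))
          (*-monoˡ-≤ _ (L≤d ρ)))))))
    where
    L≤d : ∀ ρ → size (⟦ L ⟧ ρ) ≤ value d (size ρ)
    L≤d ρ = ≤-trans (proj₁ (L-bound ρ)) (≤-trans (≤-trans (m≤m+n _ _) (m≤m+n _ _)) (start≼d (size ρ)))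
    A≤d : ∀ ρ → size (⟦ A ⟧ ρ) ≤ value d (size ρ)
    A≤d ρ = ≤-trans (proj₁ (A-bound ρ)) (≤-trans (≤-trans (m≤n+m _ (value l (size ρ))) (m≤m+n _ _)) (start≼d (size ρ)))
    ρ≤d : ∀ ρ → size ρ ≤ value d (size ρ)
    ρ≤d ρ = inflationary d (size ρ)
    F-bound′ : ∀ ρ x b n → size x ≤ n → size b ≤ n → size ρ ≤ n →
               size (⟦ F ⟧ (x ∙ b ∙ ρ)) ≤ value s n × time F (x ∙ b ∙ ρ) ≤ value s n
    F-bound′ ρ x b n x≤n b≤n ρ≤n with size≤ , time≤ ← F-bound (x ∙ b ∙ ρ) =
      ≤-trans size≤ bound , ≤-trans time≤ bound
      where
      bound : value f (size (x ∙ b ∙ ρ)) ≤ value s n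
      bound = ≤-trans (monotone f (s≤s (+-mono-≤ x≤n (s≤s (+-mono-≤ b≤n ρ≤n))))) (f∘≼s n)
    open module L ρ = Loop F s ρ (F-bound′ ρ)

-- Equality of trees

-- Depth d x: lists are nested at most d deep in x, where equal needs one
-- fold per level.
data Depth : ℕ → Tree → Set where
  nil : ∀ {d} → Depth d nil
  _∙_ : ∀ {d x xs} → Depth d x → Depth (suc d) xs → Depth (suc d) (x ∙ xs)

opaque

  -- The accumulator is `ys ∙ nil` as long as the entries agree, where `ys` is the unread part of
  -- the second list, and `nil` after a mismatch. The lists are equal if it ends as `nil ∙ nil`.
  equal : ℕ → Fun
  equal zero    = cond (snd env) leaf (cons leaf leaf)
  equal (suc d) = cond env (cond (fst env) leaf (cons leaf leaf)) leaf at
    fold (fst env) (cons (snd env) leaf)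
      (cond acc
        (cond (fst acc)
          (cond (equal d at cons (fst env) (fst (fst acc))) (cons (snd (fst acc)) leaf) leaf)
          leaf)
        leaf)
    where
    acc : Fun
    acc = fst (snd env)

  -- The recursion follows the first tree only, so the second one may have any depth.
  equal-correct : ∀ {d x} → Depth d x → ∀ y →
    (x ≡ y × ⟦ equal d ⟧ (x ∙ y) ≡ boolTree true) ⊎
    (x ≢ y × ⟦ equal d ⟧ (x ∙ y) ≡ boolTree false)
  equal-correct {zero}  nil nil     = inj₁ (refl , refl)
  equal-correct {zero}  nil (_ ∙ _) = inj₂ ((λ ()) , refl)
  equal-correct {suc d} x-depth y₀ = go x-depth y₀
    where
    result : Tree → Tree
    result = ⟦ cond env (cond (fst env) leaf (cons leaf leaf)) leaf ⟧
    step : Tree → Tree → Tree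
    step x a = ifTree a (ifTree (hd a)
      (ifTree (⟦ equal d ⟧ (x ∙ hd (hd a))) (tl (hd a) ∙ nil) nil) nil) nil
    failed : ∀ xs → foldTree step xs nil ≡ nil
    failed nil      = refl
    failed (x ∙ xs) = failed xs
    go : ∀ {x} → Depth (suc d) x → ∀ y →
         (x ≡ y × result (foldTree step x (y ∙ nil)) ≡ boolTree true) ⊎
         (x ≢ y × result (foldTree step x (y ∙ nil)) ≡ boolTree false)
    go nil nil     = inj₁ (refl , refl)
    go nil (_ ∙ _) = inj₂ ((λ ()) , refl)
    go (_∙_ {xs = xs} _ _) nil = inj₂ ((λ ()) , cong result (failed xs))
    go (_∙_ {x = x} {xs = xs} x-depth xs-depth) (y ∙ ys) with equal-correct x-depth y
    ... | inj₂ (x≢y , eq) rewrite eq = inj₂ ((λ { refl → x≢y refl }) , cong result (failed xs))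
    ... | inj₁ (refl , eq) rewrite eq with go xs-depth ys
    ...   | inj₁ (refl , eq′)  = inj₁ (refl , eq′)
    ...   | inj₂ (xs≢ys , eq′) = inj₂ ((λ { refl → xs≢ys refl }) , eq′)

bitsTree-injective : ∀ {m n} → bitsTree m ≡ bitsTree n → m ≡ n
bitsTree-injective {ℕᵇ.zero}  {ℕᵇ.zero}  eq = refl
bitsTree-injective {2[1+ m ]} {2[1+ n ]} eq = cong 2[1+_] (bitsTree-injective (cong tl eq))
bitsTree-injective {1+[2 m ]} {1+[2 n ]} eq = cong 1+[2_] (bitsTree-injective (cong tl eq))
bitsTree-injective {2[1+ m ]} {1+[2 n ]} ()
bitsTree-injective {1+[2 m ]} {2[1+ n ]} ()

bitsTree-depth : ∀ n → Depth 2 (bitsTree n)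
bitsTree-depth ℕᵇ.zero  = nil
bitsTree-depth 2[1+ n ] = nil ∙ bitsTree-depth n
bitsTree-depth 1+[2 n ] = (nil ∙ nil) ∙ bitsTree-depth n

-- Encodings of colors and pieces

listOf : ∀ {A : Set} → (A → Tree) → List A → Tree
listOf enc xs = listTree (map enc xs)

module _ {K : ℕ} where

  colorTree-injective : {c d : Fin K} → colorTree c ≡ colorTree d → c ≡ d
  colorTree-injective = Fin.toℕ-injective ∘ fromℕ-injective ∘ bitsTree-injective

  pieceTree-injective : {p q : Piece K} → pieceTree p ≡ pieceTree q → p ≡ q
  pieceTree-injective {piece r t l b} {piece r′ t′ l′ b′} eq
    with colorTree-injective {r} {r′} (cong hd eq) | colorTree-injective {t} {t′} (cong (hd ∘ tl) eq)
       | colorTree-injective {l} {l′} (cong (hd ∘ tl ∘ tl) eq)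
       | colorTree-injective {b} {b′} (cong (hd ∘ tl ∘ tl ∘ tl) eq)
  ... | refl | refl | refl | refl = refl

  opaque

    _≟ₚ_ : DecidableEquality (Piece K)
    p ≟ₚ q = map′ (cong fromTuple) (cong toTuple)
                  (≡-dec Fin._≟_ (≡-dec Fin._≟_ (≡-dec Fin._≟_ Fin._≟_)) (toTuple p) (toTuple q))
      where
      toTuple : Piece K → Fin K × Fin K × Fin K × Fin K
      toTuple (piece r t l b) = r , t , l , b
      fromTuple : Fin K × Fin K × Fin K × Fin K → Piece K
      fromTuple (r , t , l , b) = piece r t l b

equal-encodings : ∀ {A : Set} {enc : A → Tree} {d x y} → (enc x ≡ enc y → x ≡ y) →
  Depth d (enc x) → (x≟y : Dec (x ≡ y)) →
  ⟦ equal d ⟧ (enc x ∙ enc y) ≡ boolTree (does x≟y)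
equal-encodings {enc = enc} {y = y} enc-injective x-depth x≟y
  with x≟y | equal-correct x-depth (enc y)
... | yes _    | inj₁ (_ , eq)  = eq
... | yes refl | inj₂ (x≢y , _) = contradiction refl x≢y
... | no x≢y   | inj₁ (eq , _)  = contradiction (enc-injective eq) x≢y
... | no _     | inj₂ (_ , eq)  = eq

module _ {K : ℕ} where

  equal-colors : (c d : Fin K) →
    ⟦ equal 2 ⟧ (colorTree c ∙ colorTree d) ≡ boolTree (does (c Fin.≟ d))
  equal-colors c d = equal-encodings {enc = colorTree} colorTree-injective (bitsTree-depth _) (c Fin.≟ d)

  equal-pieces : (p q : Piece K) →
    ⟦ equal 3 ⟧ (pieceTree p ∙ pieceTree q) ≡ boolTree (does (p ≟ₚ q))
  equal-pieces p q = equal-encodings {enc = pieceTree} pieceTree-injective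
    (bitsTree-depth _ ∙ (bitsTree-depth _ ∙ (bitsTree-depth _ ∙ (bitsTree-depth _ ∙ nil)))) (p ≟ₚ q)

-- Simulation of list functions

foldTree-listOf : ∀ {A B : Set} (encA : A → Tree) (encB : B → Tree) {F : Tree → Tree → Tree} {f : B → A → B} →
  (∀ x b → F (encA x) (encB b) ≡ encB (f b x)) →
  ∀ xs b → foldTree F (listOf encA xs) (encB b) ≡ encB (foldl f b xs)
foldTree-listOf encA encB         F≡f []       b = refl
foldTree-listOf encA encB {f = f} F≡f (x ∷ xs) b rewrite F≡f x b =
  foldTree-listOf encA encB F≡f xs (f b x)

-- A concatenation in scrambled order: a left fold can only push onto its accumulator, and only
-- membership in the result matters.
collect : ∀ {A B : Set} → (A → List B) → List A → List B
collect f = foldl (λ acc x → f x ʳ++ acc) []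

-- G runs in the environment x ∙ ρ for each x in the list L.
collecting : Fun → Fun → Fun
collecting L G = fold L leaf
  (fold (G at cons (fst env) (snd (snd env))) (fst (snd env))
    (cons (fst env) (fst (snd env))))

collecting-correct : ∀ {A B : Set} (encA : A → Tree) (encB : B → Tree) L G ρ xs (f : A → List B) →
  ⟦ L ⟧ ρ ≡ listOf encA xs → (∀ x → ⟦ G ⟧ (encA x ∙ ρ) ≡ listOf encB (f x)) →
  ⟦ collecting L G ⟧ ρ ≡ listOf encB (collect f xs)
collecting-correct encA encB L G ρ xs f L≡xs G≡f rewrite L≡xs =
  foldTree-listOf encA (listOf encB) push xs []
  where
  push : ∀ x acc → foldTree (λ z a → z ∙ a) (⟦ G ⟧ (encA x ∙ ρ)) (listOf encB acc) ≡
                   listOf encB (f x ʳ++ acc)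
  push x acc rewrite G≡f x = foldTree-listOf encB (listOf encB) (λ _ _ → refl) (f x) acc

module _ {K : ℕ} where

  piecesTree : List (Piece K) → Tree
  piecesTree = listOf pieceTree

  -- Kernelization

  sieve : Piece K → List (Piece K) × List (Piece K) → Piece K → List (Piece K) × List (Piece K)
  sieve p (same , others) x =
    if does (x ≟ₚ p) then (x ∷ same , others) else (same , x ∷ others)

  -- Four copies in the kernel and p itself become three.
  restock : Piece K → List (Piece K) → List (Piece K) × List (Piece K) → List (Piece K)
  restock p kernel (_ ∷ _ ∷ _ ∷ _ ∷ _ , others) = p ∷ p ∷ p ∷ others
  restock p kernel _                            = p ∷ kernel

  add : Piece K → List (Piece K) → List (Piece K)
  add p kernel = restock p kernel (foldl (sieve p) ([] , []) kernel)

kernelize : ∀ {K} → List (Piece K) → List (Piece K)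
kernelize = foldl (λ kernel p → add p kernel) []

sieveFun : Fun
sieveFun = fold (snd env) (cons leaf leaf)
  (cond (equal 3 at cons x (fst (snd (snd env))))
    (cons (cons x (fst acc)) (snd acc))
    (cons (fst acc) (cons x (snd acc))))
  where
  x   = fst env
  acc = fst (snd env)

-- Past three entries, `same` is non-`nil` exactly if it has at least four. Otherwise the tree
-- `p ∙ kernel` is returned as it stands, being also the encoding of `p ∷ kernel`.
addFun : Fun
addFun =
  cond (snd (snd (snd (fst (fst env)))))
    (cons p (cons p (cons p (snd (fst env)))))
    (snd env)
  at cons sieveFun env
  where p = fst (snd env)

kernelizeFun : Fun
kernelizeFun = fold (snd env) leaf (addFun at cons (fst env) (fst (snd env)))

sieveFun-correct : ∀ {K} (p : Piece K) kernel →
  let same , others = foldl (sieve p) ([] , []) kernel in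
  ⟦ sieveFun ⟧ (pieceTree p ∙ piecesTree kernel) ≡ piecesTree same ∙ piecesTree others
sieveFun-correct {K} p kernel = foldTree-listOf pieceTree pairTree step kernel ([] , [])
  where
  pairTree : List (Piece K) × List (Piece K) → Tree
  pairTree (same , others) = piecesTree same ∙ piecesTree others
  step : ∀ x acc →
    ifTree (⟦ equal 3 ⟧ (pieceTree x ∙ pieceTree p))
      ((pieceTree x ∙ hd (pairTree acc)) ∙ tl (pairTree acc))
      (hd (pairTree acc) ∙ (pieceTree x ∙ tl (pairTree acc))) ≡
    pairTree (sieve p acc x)
  step x acc rewrite equal-pieces x p with does (x ≟ₚ p)
  ... | true  = refl
  ... | false = refl

addFun-correct : ∀ {K} (p : Piece K) kernel →
  ⟦ addFun ⟧ (pieceTree p ∙ piecesTree kernel) ≡ piecesTree (add p kernel)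
addFun-correct p kernel
  rewrite sieveFun-correct p kernel with foldl (sieve p) ([] , []) kernel
... | []                , _ = refl
... | _ ∷ []            , _ = refl
... | _ ∷ _ ∷ []        , _ = refl
... | _ ∷ _ ∷ _ ∷ []    , _ = refl
... | _ ∷ _ ∷ _ ∷ _ ∷ _ , _ = refl

kernelizeFun-correct : ∀ {K} (pieces : List (Piece K)) k →
  ⟦ kernelizeFun ⟧ (k ∙ piecesTree pieces) ≡ piecesTree (kernelize pieces)
kernelizeFun-correct pieces k = foldTree-listOf pieceTree piecesTree addFun-correct pieces []

-- Exhaustive search

-- A row is built from right to left.  A state consists of the color at its
-- left end (nothing for the empty row) and of the unused pieces.
State : ℕ → Set
State K = Maybe (Fin K) × List (Piece K)

module _ {K : ℕ} where

  accepts : Maybe (Fin K) → Fin K → Bool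
  accepts nothing  d = true
  accepts (just c) d = does (c Fin.≟ d)

  opaque

    attach : Piece K → State K → Fin 4 → List (State K) → List (State K)
    attach p (c , rest) q acc =
      if accepts c (right (rotate q p)) then (just (left (rotate q p)) , rest) ∷ acc else acc

  successors : Piece K → State K → List (State K)
  successors p s@(c , rest) =
    attach p s zero $′ attach p s (suc zero) $′
    attach p s (suc (suc zero)) $′ attach p s (suc (suc (suc zero))) $′
    (c , p ∷ rest) ∷ []

  passStep : List (State K) → Piece K → List (State K)
  passStep states p = collect (successors p) states

  pass : State K → List (State K)
  pass (c , rest) = foldl passStep ((c , []) ∷ []) rest

  -- Every pass can attach the next piece of a given row, so as many passes
  -- as there are pieces suffice.
  search : List (Piece K) → List (State K)
  search kernel = foldl (λ states _ → collect pass states) ((nothing , kernel) ∷ []) kernel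

  exhausts : List (Piece K) → Bool
  exhausts kernel = foldl (λ b (_ , rest) → if null rest then true else b) false (search kernel)

  maybeTree : Maybe (Fin K) → Tree
  maybeTree nothing  = nil
  maybeTree (just c) = colorTree c ∙ nil

  stateTree : State K → Tree
  stateTree (c , rest) = maybeTree c ∙ piecesTree rest

acceptsFun : Fun
acceptsFun = cond (fst env) (equal 2 at cons (fst (fst env)) (snd env)) (cons leaf leaf)

acceptsFun-correct : ∀ {K} c (d : Fin K) →
  ⟦ acceptsFun ⟧ (maybeTree c ∙ colorTree d) ≡ boolTree (accepts c d)
acceptsFun-correct nothing  d = refl
acceptsFun-correct (just c) d = equal-colors c d

-- `r` and `l` select those sides of the unturned piece that face right and left after the turn.
attachFun : Fun → Fun → Fun → Fun
attachFun r l A =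
  cond (acceptsFun at cons (fst (snd env)) (r at fst env))
    (cons (cons (cons (l at fst env) leaf) (snd (snd env))) A) A

opaque
  unfolding attach

  attachFun-correct : ∀ {K} r l A (p : Piece K) s q {acc} →
    ⟦ r ⟧ (pieceTree p) ≡ colorTree (right (rotate q p)) →
    ⟦ l ⟧ (pieceTree p) ≡ colorTree (left (rotate q p)) →
    ⟦ A ⟧ (pieceTree p ∙ stateTree s) ≡ listOf stateTree acc →
    ⟦ attachFun r l A ⟧ (pieceTree p ∙ stateTree s) ≡ listOf stateTree (attach p s q acc)
  attachFun-correct r l A p s@(c , _) q r-eq l-eq A-eq
    rewrite r-eq | l-eq | A-eq | acceptsFun-correct c (right (rotate q p))
    with accepts c (right (rotate q p))
  ... | true  = refl
  ... | false = refl

module Successors where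

  r t l b skip : Fun
  r    = fst env
  t    = fst (snd env)
  l    = fst (snd (snd env))
  b    = fst (snd (snd (snd env)))
  skip = cons (cons (fst (snd env)) (cons (fst env) (snd (snd env)))) leaf

  A₁ A₂ A₃ A₄ : Fun
  A₁ = attachFun t b skip
  A₂ = attachFun l r A₁
  A₃ = attachFun b t A₂
  A₄ = attachFun r l A₃

open Successors using () renaming (A₄ to successorsFun)

successorsFun-correct : ∀ {K} (p : Piece K) s →
  ⟦ successorsFun ⟧ (pieceTree p ∙ stateTree s) ≡ listOf stateTree (successors p s)
successorsFun-correct p s =
  attachFun-correct r l A₃ p s zero refl refl $′
  attachFun-correct b t A₂ p s (suc zero) refl refl $′
  attachFun-correct l r A₁ p s (suc (suc zero)) refl refl $′
  attachFun-correct t b skip p s (suc (suc (suc zero))) refl refl refl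
  where open Successors

passFun : Fun
passFun = fold (snd (fst env)) (cons (cons (fst (fst env)) leaf) leaf)
  (collecting (fst (snd env)) (successorsFun at cons (fst (snd env)) (fst env)))

passFun-correct : ∀ {K} (s : State K) ρ →
  ⟦ passFun ⟧ (stateTree s ∙ ρ) ≡ listOf stateTree (pass s)
passFun-correct s@(c , rest) ρ = foldTree-listOf pieceTree (listOf stateTree)
  (λ p states → collecting-correct stateTree stateTree
    (fst (snd env)) (successorsFun at cons (fst (snd env)) (fst env))
    (pieceTree p ∙ listOf stateTree states ∙ stateTree s ∙ ρ)
    states (successors p) refl (successorsFun-correct p))
  rest ((c , []) ∷ [])

searchFun : Fun
searchFun = fold env (cons (cons leaf env) leaf) (collecting (fst (snd env)) passFun)

searchFun-correct : ∀ {K} (kernel : List (Piece K)) →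
  ⟦ searchFun ⟧ (piecesTree kernel) ≡ listOf stateTree (search kernel)
searchFun-correct kernel = foldTree-listOf pieceTree (listOf stateTree)
  (λ p states → collecting-correct stateTree stateTree
    (fst (snd env)) passFun (pieceTree p ∙ listOf stateTree states ∙ piecesTree kernel)
    states pass refl (λ s → passFun-correct s (pieceTree p ∙ listOf stateTree states ∙ piecesTree kernel)))
  kernel ((nothing , kernel) ∷ [])

exhaustsFun : Fun
exhaustsFun = fold searchFun leaf (cond (snd (fst env)) (fst (snd env)) (cons leaf leaf))

exhaustsFun-correct : ∀ {K} (kernel : List (Piece K)) →
  ⟦ exhaustsFun ⟧ (piecesTree kernel) ≡ boolTree (exhausts kernel)
exhaustsFun-correct {K} kernel rewrite searchFun-correct kernel =
  foldTree-listOf stateTree boolTree step (search kernel) false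
  where
  step : ∀ (s : State K) b → ifTree (tl (stateTree s)) (boolTree b) (boolTree true) ≡
                           boolTree (if null (proj₂ s) then true else b)
  step (_ , [])    b = refl
  step (_ , _ ∷ _) b = refl

decider : Fun
decider = exhaustsFun at kernelizeFun

decider-correct : ∀ {K} (pieces : List (Piece K)) k →
  ⟦ decider ⟧ (k ∙ piecesTree pieces) ≡ boolTree (exhausts (kernelize pieces))
decider-correct pieces k rewrite kernelizeFun-correct pieces k = exhaustsFun-correct (kernelize pieces)

-- Rows of pieces

Placed : ℕ → Set
Placed K = Piece K × Fin 4

module _ {K : ℕ} where

  turned : Placed K → Piece K
  turned (p , q) = rotate q p

  Touching : Placed K → Placed K → Set
  Touching x y = right (turned x) ≡ left (turned y)

  -- A form of `Placeable` without positions, in which a row can be cut, reversed and glued as a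
  -- list.
  Arrangeable : List (Piece K) → Set
  Arrangeable pieces = ∃[ row ] Linked Touching row × map proj₁ row ↭ pieces

-- Correctness of the search

collect⁻ : ∀ {A B : Set} (f : A → List B) xs {z} → z ∈ collect f xs → Any (λ x → z ∈ f x) xs
collect⁻ f xs {z} z∈ with go xs [] z∈
  where
  go : ∀ xs acc → z ∈ foldl (λ acc x → f x ʳ++ acc) acc xs → z ∈ acc ⊎ Any (λ x → z ∈ f x) xs
  go []       acc z∈ = inj₁ z∈
  go (x ∷ xs) acc z∈ with go xs (f x ʳ++ acc) z∈
  ... | inj₂ later = inj₂ (there later)
  ... | inj₁ z∈′ with reverseAcc⁻ acc (f x) z∈′
  ...   | inj₁ z∈acc = inj₁ z∈acc
  ...   | inj₂ z∈fx  = inj₂ (here z∈fx)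
... | inj₂ found = found

collect⁺ : ∀ {A B : Set} (f : A → List B) xs {z} → Any (λ x → z ∈ f x) xs → z ∈ collect f xs
collect⁺ f xs {z} found = go xs [] (inj₂ found)
  where
  go : ∀ xs acc → z ∈ acc ⊎ Any (λ x → z ∈ f x) xs → z ∈ foldl (λ acc x → f x ʳ++ acc) acc xs
  go []       acc (inj₁ z∈acc)        = z∈acc
  go (x ∷ xs) acc (inj₁ z∈acc)        = go xs (f x ʳ++ acc) (inj₁ (reverseAcc⁺ acc (f x) (inj₁ z∈acc)))
  go (x ∷ xs) acc (inj₂ (here z∈fx))  = go xs (f x ʳ++ acc) (inj₁ (reverseAcc⁺ acc (f x) (inj₂ z∈fx)))
  go (x ∷ xs) acc (inj₂ (there rest)) = go xs (f x ʳ++ acc) (inj₂ rest)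

module _ {K : ℕ} where

  leftEnd : List (Placed K) → Maybe (Fin K)
  leftEnd []      = nothing
  leftEnd (x ∷ _) = just (left (turned x))

  accepts⇒linked : ∀ x row → accepts (leftEnd row) (right (turned x)) ≡ true →
                   Linked Touching row → Linked Touching (x ∷ row)
  accepts⇒linked x []        _  _      = [-]
  accepts⇒linked x (y ∷ row) ok linked with left (turned y) Fin.≟ right (turned x)
  ... | yes eq = sym eq ∷ linked

  linked⇒accepts : ∀ x row → Linked Touching (x ∷ row) →
                   accepts (leftEnd row) (right (turned x)) ≡ true × Linked Touching row
  linked⇒accepts x []        _             = refl , []
  linked⇒accepts x (y ∷ row) (eq ∷ linked) =
    dec-true (left (turned y) Fin.≟ right (turned x)) (sym eq) , linked

  Attached : Piece K → State K → State K → Set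
  Attached p (c , rest) z =
    ∃[ q ] accepts c (right (rotate q p)) ≡ true × z ≡ (just (left (rotate q p)) , rest)

  opaque
    unfolding attach

    attach⁻ : ∀ (p : Piece K) (s : State K) q acc {z} → z ∈ attach p s q acc → Attached p s z ⊎ z ∈ acc
    attach⁻ p (c , rest) q acc {z} = go (accepts c (right (rotate q p))) refl
      where
      go : ∀ b → accepts c (right (rotate q p)) ≡ b →
           z ∈ (if b then (just (left (rotate q p)) , rest) ∷ acc else acc) →
           Attached p (c , rest) z ⊎ z ∈ acc
      go true  ok (here eq)  = inj₁ (q , ok , eq)
      go true  ok (there z∈) = inj₂ z∈
      go false _  z∈         = inj₂ z∈

    attach⁺ˡ : ∀ (p : Piece K) (s : State K) q acc → accepts (proj₁ s) (right (rotate q p)) ≡ true →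
               (just (left (rotate q p)) , proj₂ s) ∈ attach p s q acc
    attach⁺ˡ p (c , rest) q acc ok =
      subst (λ b → z ∈ (if b then z ∷ acc else acc)) (sym ok) (here refl)
      where
      z : State K
      z = just (left (rotate q p)) , rest

    attach⁺ʳ : ∀ (p : Piece K) (s : State K) q acc {z} → z ∈ acc → z ∈ attach p s q acc
    attach⁺ʳ p (c , rest) q acc {z} z∈ = go (accepts c (right (rotate q p)))
      where
      go : ∀ b → z ∈ (if b then (just (left (rotate q p)) , rest) ∷ acc else acc)
      go true  = there z∈
      go false = z∈

  successors⁻ : ∀ (p : Piece K) (s : State K) {z} → z ∈ successors p s → Attached p s z ⊎ z ≡ (proj₁ s , p ∷ proj₂ s)
  successors⁻ p s z∈₀ with attach⁻ p s zero _ z∈₀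
  ... | inj₁ attached = inj₁ attached
  ... | inj₂ z∈₁ with attach⁻ p s (suc zero) _ z∈₁
  ...   | inj₁ attached = inj₁ attached
  ...   | inj₂ z∈₂ with attach⁻ p s (suc (suc zero)) _ z∈₂
  ...     | inj₁ attached = inj₁ attached
  ...     | inj₂ z∈₃ with attach⁻ p s (suc (suc (suc zero))) _ z∈₃
  ...       | inj₁ attached  = inj₁ attached
  ...       | inj₂ (here eq) = inj₂ eq

  skip∈successors : ∀ (p : Piece K) (s : State K) → (proj₁ s , p ∷ proj₂ s) ∈ successors p s
  skip∈successors p s =
    attach⁺ʳ p s zero _ $′ attach⁺ʳ p s (suc zero) _ $′
    attach⁺ʳ p s (suc (suc zero)) _ $′ attach⁺ʳ p s (suc (suc (suc zero))) _ $′ here refl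

  attach∈successors : ∀ (p : Piece K) (s : State K) q → accepts (proj₁ s) (right (rotate q p)) ≡ true →
                      (just (left (rotate q p)) , proj₂ s) ∈ successors p s
  attach∈successors p s zero ok = attach⁺ˡ p s zero _ ok
  attach∈successors p s (suc zero) ok =
    attach⁺ʳ p s zero _ $′ attach⁺ˡ p s (suc zero) _ ok
  attach∈successors p s (suc (suc zero)) ok =
    attach⁺ʳ p s zero _ $′ attach⁺ʳ p s (suc zero) _ $′ attach⁺ˡ p s (suc (suc zero)) _ ok
  attach∈successors p s (suc (suc (suc zero))) ok =
    attach⁺ʳ p s zero _ $′ attach⁺ʳ p s (suc zero) _ $′ attach⁺ʳ p s (suc (suc zero)) _ $′
    attach⁺ˡ p s (suc (suc (suc zero))) _ ok

  -- In the middle of a pass, pending is the part of the list that has not been visited.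
  Reachable : List (Piece K) → List (Piece K) → State K → Set
  Reachable kernel pending (c , rest) =
    ∃[ row ] Linked Touching row × leftEnd row ≡ c × map proj₁ row ++ rest ++ pending ↭ kernel

  successors-reachable : ∀ {kernel p pending s z} → Reachable kernel (p ∷ pending) s →
                         z ∈ successors p s → Reachable kernel pending z
  successors-reachable {p = p} {pending} {s = c , rest} (row , linked , refl , perm) z∈
    with successors⁻ p (c , rest) z∈
  ... | inj₂ refl = row , linked , refl ,
    ↭-trans (++⁺ˡ (map proj₁ row) (↭-sym (shift p rest pending))) perm
  ... | inj₁ (q , ok , refl) = (p , q) ∷ row , accepts⇒linked (p , q) row ok linked , refl ,
    ↭-trans (↭-sym (shift p (map proj₁ row) (rest ++ pending)))
      (↭-trans (++⁺ˡ (map proj₁ row) (↭-sym (shift p rest pending))) perm)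

  foldl-passStep-reachable : ∀ {kernel} pending states →
    (∀ {z} → z ∈ states → Reachable kernel pending z) →
    ∀ {z} → z ∈ foldl passStep states pending → Reachable kernel [] z
  foldl-passStep-reachable []            states reachable z∈ = reachable z∈
  foldl-passStep-reachable (p ∷ pending) states reachable z∈ =
    foldl-passStep-reachable pending (passStep states p) step z∈
    where
    step : ∀ {z} → z ∈ passStep states p → Reachable _ pending z
    step z∈ with s , s∈ , z∈succ ← find (collect⁻ (successors p) states z∈) =
      successors-reachable (reachable s∈) z∈succ

  pass-reachable : ∀ {kernel s z} → Reachable kernel [] s → z ∈ pass s → Reachable kernel [] z
  pass-reachable {s = c , rest} (row , linked , eq , perm) =
    -- At the start of a pass nothing has been put back and all of `rest` is pending.
    foldl-passStep-reachable rest ((c , []) ∷ [])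
      λ { (here refl) → row , linked , eq ,
            subst (λ l → map proj₁ row ++ l ↭ _) (++-identityʳ rest) perm }

  search-reachable : ∀ {kernel} rounds states →
    (∀ {z} → z ∈ states → Reachable kernel [] z) →
    ∀ {z} → z ∈ foldl (λ states (_ : Piece K) → collect pass states) states rounds →
    Reachable kernel [] z
  search-reachable []           states reachable z∈ = reachable z∈
  search-reachable (_ ∷ rounds) states reachable z∈ =
    search-reachable rounds (collect pass states) step z∈
    where
    step : ∀ {z} → z ∈ collect pass states → Reachable _ [] z
    step z∈ with s , s∈ , z∈pass ← find (collect⁻ pass states z∈) = pass-reachable (reachable s∈) z∈pass

  skip-all : ∀ pending {states c rest} → (c , rest) ∈ states →
             (c , pending ʳ++ rest) ∈ foldl passStep states pending
  skip-all []            s∈ = s∈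
  skip-all (p ∷ pending) s∈ =
    skip-all pending (collect⁺ (successors p) _ (lose s∈ (skip∈successors p _)))

  -- All pieces before `p` are put back, `p` is attached, and all pieces after it are put back;
  -- putting back reverses their order.
  pass-attach : ∀ l₁ l₂ p q c → accepts c (right (rotate q p)) ≡ true →
    (just (left (rotate q p)) , l₂ ʳ++ (l₁ ʳ++ [])) ∈ pass (c , l₁ ++ p ∷ l₂)
  pass-attach l₁ l₂ p q c ok
    rewrite foldl-++ passStep ((c , []) ∷ []) l₁ (p ∷ l₂) =
    skip-all l₂ (collect⁺ (successors p) _
      (lose (skip-all l₁ (here refl)) (attach∈successors p (c , l₁ ʳ++ []) q ok)))

  -- The last pass is outermost here, which suits induction on a row: its head is the leftmost
  -- piece, attached last.
  rounds : List (Piece K) → ℕ → List (State K)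
  rounds kernel = foldℕ ((nothing , kernel) ∷ []) (collect pass)

  search≡rounds : ∀ kernel → search kernel ≡ rounds kernel (length kernel)
  search≡rounds kernel = go kernel _
    where
    fold-shift : ∀ n states → foldℕ (collect pass states) (collect pass) n ≡
                              collect pass (foldℕ states (collect pass) n)
    fold-shift zero    states = refl
    fold-shift (suc n) states = cong (collect pass) (fold-shift n states)
    go : ∀ (xs : List (Piece K)) states → foldl (λ states _ → collect pass states) states xs ≡
                      foldℕ states (collect pass) (length xs)
    go []       states = refl
    go (_ ∷ xs) states = trans (go xs (collect pass states)) (fold-shift (length xs) states)

  rounds-complete : ∀ kernel row {rest} → Linked Touching row → map proj₁ row ++ rest ↭ kernel →
    ∃[ rest′ ] (leftEnd row , rest′) ∈ rounds kernel (length row) × rest′ ↭ rest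
  rounds-complete kernel []        linked perm = kernel , here refl , ↭-sym perm
  rounds-complete kernel ((p , q) ∷ row) {rest} linked perm
    with ok , linked′ ← linked⇒accepts (p , q) row linked
    with rest₁ , s∈ , perm₁ ← rounds-complete kernel row linked′
                                (↭-trans (shift p (map proj₁ row) rest) perm)
    with l₁ , l₂ , refl ← ∈-∃++ (∈-resp-↭ (↭-sym perm₁) (here refl)) =
    l₂ ʳ++ (l₁ ʳ++ []) ,
    collect⁺ pass _ (lose s∈ (pass-attach l₁ l₂ p q (leftEnd row) ok)) ,
    (begin
      l₂ ʳ++ (l₁ ʳ++ []) ↭⟨ ++↭ʳ++ l₂ (l₁ ʳ++ []) ⟨
      l₂ ++ (l₁ ʳ++ [])  ↭⟨ ++⁺ˡ l₂ (++↭ʳ++ l₁ []) ⟨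
      l₂ ++ (l₁ ++ [])   ≡⟨ cong (l₂ ++_) (++-identityʳ l₁) ⟩
      l₂ ++ l₁           ↭⟨ ++-comm l₂ l₁ ⟩
      l₁ ++ l₂           ↭⟨ drop-∷ (↭-trans (↭-sym (shift p l₁ l₂)) perm₁) ⟩
      rest               ∎)
    where open PermutationReasoning

  Exhausted : State K → Set
  Exhausted s = proj₂ s ≡ []

  anyExhausted : Bool → List (State K) → Bool
  anyExhausted = foldl (λ b (_ , rest) → if null rest then true else b)

  anyExhausted⁻ : ∀ b states → anyExhausted b states ≡ true → b ≡ true ⊎ Any Exhausted states
  anyExhausted⁻ b []                      eq = inj₁ eq
  anyExhausted⁻ b ((_ , [])     ∷ states) eq = inj₂ (here refl)
  anyExhausted⁻ b ((_ , _ ∷ _)  ∷ states) eq with anyExhausted⁻ b states eq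
  ... | inj₁ b≡true = inj₁ b≡true
  ... | inj₂ found  = inj₂ (there found)

  anyExhausted⁺ : ∀ b states → b ≡ true ⊎ Any Exhausted states → anyExhausted b states ≡ true
  anyExhausted⁺ b []                     (inj₁ eq)           = eq
  anyExhausted⁺ b ((_ , [])    ∷ states) _                   = anyExhausted⁺ true states (inj₁ refl)
  anyExhausted⁺ b ((_ , _ ∷ _) ∷ states) (inj₁ eq)           = anyExhausted⁺ b states (inj₁ eq)
  anyExhausted⁺ b ((_ , _ ∷ _) ∷ states) (inj₂ (there found)) = anyExhausted⁺ b states (inj₂ found)

  exhausts-sound : ∀ kernel → exhausts kernel ≡ true → Arrangeable kernel
  exhausts-sound kernel eq with anyExhausted⁻ false (search kernel) eq
  ... | inj₂ found with (c , .[]) , s∈ , refl ← find found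
    with row , linked , _ , perm ← search-reachable kernel ((nothing , kernel) ∷ [])
           (λ { (here refl) → [] , [] , refl , ↭-reflexive (++-identityʳ kernel) }) s∈ =
    row , linked , subst (_↭ kernel) (++-identityʳ (map proj₁ row)) perm

  exhausts-complete : ∀ kernel → Arrangeable kernel → exhausts kernel ≡ true
  exhausts-complete kernel (row , linked , perm)
    with rest , s∈ , rest↭[] ← rounds-complete kernel row linked
           (↭-trans (↭-reflexive (++-identityʳ (map proj₁ row))) perm)
    with refl ← ↭-empty-inv rest↭[] =
    anyExhausted⁺ false (search kernel) (inj₂ (lose s∈search refl))
    where
    s∈search : (leftEnd row , []) ∈ search kernel
    s∈search = subst ((leftEnd row , []) ∈_)
      -- The row uses every piece, so the number of passes it needs is the length of the kernel.
      (trans (cong (rounds kernel) (trans (sym (length-map proj₁ row)) (↭-length perm)))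
             (sym (search≡rounds kernel))) s∈

pick-two : ∀ {A : Set} (xs : List A) {i j} → i Fin.< j →
           ∃[ ys ] xs ↭ List.lookup xs i ∷ List.lookup xs j ∷ ys
pick-two (x ∷ xs) {zero}  {suc j} _
  with l₁ , l₂ , eq ← ∈-∃++ (∈-lookup {xs = xs} j) =
  l₁ ++ l₂ , ↭-prep x (↭-trans (↭-reflexive eq) (shift _ l₁ l₂))
pick-two (x ∷ xs) {suc i} {suc j} (s≤s i<j) with ys , perm ← pick-two xs i<j =
  x ∷ ys , ↭-trans (↭-prep x perm) (↭-sym (shift x (_ ∷ _ ∷ []) ys))

-- Walks

module _ {K : ℕ} where

  -- Unlike `Linked`, this records both end colors. An empty walk must be closed, which covers the
  -- case of nothing lying between two equal pieces.
  data Walk : Fin K → List (Placed K) → Fin K → Set where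
    []  : ∀ {a} → Walk a [] a
    _∷_ : ∀ {a b} x {xs} → left (turned x) ≡ a × Walk (right (turned x)) xs b → Walk a (x ∷ xs) b

  Walk⇒Linked : ∀ {a xs b} → Walk a xs b → Linked Touching xs
  Walk⇒Linked []                          = []
  Walk⇒Linked (x ∷ (_ , []))              = [-]
  Walk⇒Linked (x ∷ (_ , (y ∷ (eq , w))))  = sym eq ∷ Walk⇒Linked (y ∷ (eq , w))

  Linked⇒Walk : ∀ x xs → Linked Touching (x ∷ xs) → ∃[ b ] Walk (left (turned x)) (x ∷ xs) b
  Linked⇒Walk x []       _             = _ , x ∷ (refl , [])
  Linked⇒Walk x (y ∷ xs) (eq ∷ linked) with b , w ← Linked⇒Walk y xs linked =
    b , x ∷ (refl , subst (λ a → Walk a (y ∷ xs) b) (sym eq) w)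

  _++ʷ_ : ∀ {a b c xs ys} → Walk a xs b → Walk b ys c → Walk a (xs ++ ys) c
  []             ++ʷ v = v
  (x ∷ (eq , w)) ++ʷ v = x ∷ (eq , w ++ʷ v)

  splitʷ : ∀ xs {ys a c} → Walk a (xs ++ ys) c → ∃[ b ] Walk a xs b × Walk b ys c
  splitʷ []       w              = _ , [] , w
  splitʷ (x ∷ xs) (.x ∷ (eq , w)) with b , u , v ← splitʷ xs w = b , x ∷ (eq , u) , v

  -- The same edge of the multigraph, traversed backwards.
  halfTurn : Placed K → Placed K
  halfTurn (p , zero)                = p , suc (suc zero)
  halfTurn (p , suc zero)            = p , suc (suc (suc zero))
  halfTurn (p , suc (suc zero))      = p , zero
  halfTurn (p , suc (suc (suc zero))) = p , suc zero

  halfTurn-piece : ∀ x → proj₁ (halfTurn x) ≡ proj₁ x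
  halfTurn-piece (p , zero)                 = refl
  halfTurn-piece (p , suc zero)             = refl
  halfTurn-piece (p , suc (suc zero))       = refl
  halfTurn-piece (p , suc (suc (suc zero))) = refl

  halfTurn-left : ∀ x → left (turned (halfTurn x)) ≡ right (turned x)
  halfTurn-left (p , zero)                 = refl
  halfTurn-left (p , suc zero)             = refl
  halfTurn-left (p , suc (suc zero))       = refl
  halfTurn-left (p , suc (suc (suc zero))) = refl

  halfTurn-right : ∀ x → right (turned (halfTurn x)) ≡ left (turned x)
  halfTurn-right (p , zero)                 = refl
  halfTurn-right (p , suc zero)             = refl
  halfTurn-right (p , suc (suc zero))       = refl
  halfTurn-right (p , suc (suc (suc zero))) = refl

  mirror : List (Placed K) → List (Placed K)
  mirror []       = []
  mirror (x ∷ xs) = mirror xs ++ halfTurn x ∷ []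

  mirrorʷ : ∀ {a xs b} → Walk a xs b → Walk b (mirror xs) a
  mirrorʷ []               = []
  mirrorʷ (x ∷ (refl , w)) = mirrorʷ w ++ʷ
    (halfTurn x ∷ (halfTurn-left x , subst (λ c → Walk c [] (left (turned x))) (sym (halfTurn-right x)) []))

  pieces : List (Placed K) → List (Piece K)
  pieces = map proj₁

  pieces-mirror : ∀ xs → pieces (mirror xs) ↭ pieces xs
  pieces-mirror []       = ↭-refl
  pieces-mirror (x ∷ xs) = begin
    pieces (mirror xs ++ halfTurn x ∷ [])         ≡⟨ map-++ proj₁ (mirror xs) _ ⟩
    pieces (mirror xs) ++ proj₁ (halfTurn x) ∷ [] ≡⟨ cong (λ p → pieces (mirror xs) ++ p ∷ []) (halfTurn-piece x) ⟩
    pieces (mirror xs) ++ proj₁ x ∷ []            ↭⟨ ++-comm (pieces (mirror xs)) _ ⟩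
    proj₁ x ∷ pieces (mirror xs)                  ↭⟨ ↭-prep (proj₁ x) (pieces-mirror xs) ⟩
    pieces (x ∷ xs)                               ∎
    where open PermutationReasoning

  Arrangeable-resp-↭ : ∀ {ps qs : List (Piece K)} → ps ↭ qs → Arrangeable ps → Arrangeable qs
  Arrangeable-resp-↭ ps↭qs (row , linked , perm) = row , linked , ↭-trans perm ps↭qs

  Arrangeable⇒Walk : ∀ {p} {ps : List (Piece K)} → Arrangeable (p ∷ ps) →
    ∃[ a ] ∃[ b ] ∃[ row ] Walk a row b × pieces row ↭ p ∷ ps
  Arrangeable⇒Walk ([]      , linked , perm) = contradiction (↭-sym perm) ¬x∷xs↭[]
  Arrangeable⇒Walk (x ∷ row , linked , perm) with b , w ← Linked⇒Walk x row linked =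
    _ , b , x ∷ row , w , perm

  -- A placed copy x of p is replaced by x, x turned by 180° and x again.
  insert-two : ∀ p (ps : List (Piece K)) → Arrangeable (p ∷ ps) → Arrangeable (p ∷ p ∷ p ∷ ps)
  insert-two p ps arr
    with a , b , row , w , perm ← Arrangeable⇒Walk arr
    -- Lifted to placed pieces, the permutation exhibits a copy of `p` together with its
    -- orientation.
    with row′ , eq , row↭ ← ↭-map-inv proj₁ perm
    with row′ | eq
  ... | x ∷ tail | refl
    with r₁ , r₂ , refl ← ∈-∃++ (∈-resp-↭ (↭-sym row↭) (here refl))
    with _ , u , (_ ∷ (refl , v)) ← splitʷ r₁ w =
    r₁ ++ x ∷ halfTurn x ∷ x ∷ r₂ ,
    Walk⇒Linked (u ++ʷ (x ∷ (refl , halfTurn x ∷ (halfTurn-left x , x ∷ (sym (halfTurn-right x) , v))))) ,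
    (begin
      pieces (r₁ ++ x ∷ halfTurn x ∷ x ∷ r₂)  ↭⟨ map⁺ proj₁ (shift x r₁ (halfTurn x ∷ x ∷ r₂)) ⟩
      pieces (x ∷ r₁ ++ halfTurn x ∷ x ∷ r₂)  ↭⟨ ↭-prep p (map⁺ proj₁ (shift (halfTurn x) r₁ (x ∷ r₂))) ⟩
      p ∷ proj₁ (halfTurn x) ∷ pieces (r₁ ++ x ∷ r₂) ≡⟨ cong (λ p′ → p ∷ p′ ∷ pieces (r₁ ++ x ∷ r₂)) (halfTurn-piece x) ⟩
      p ∷ p ∷ pieces (r₁ ++ x ∷ r₂)  ↭⟨ ↭-prep p (↭-prep p perm) ⟩
      p ∷ p ∷ p ∷ ps ∎)
    where open PermutationReasoning

  turned-alike : ∀ {p} {ps : List (Piece K)} row → pieces row ↭ p ∷ p ∷ p ∷ p ∷ p ∷ ps →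
    ∃[ q ] ∃[ row′ ] row ↭ (p , q) ∷ (p , q) ∷ row′
  turned-alike {p} row perm
    with row′ , eq , row↭ ← ↭-map-inv proj₁ perm
    with row′ | eq
  ... | (_ , q₁) ∷ (_ , q₂) ∷ (_ , q₃) ∷ (_ , q₄) ∷ (_ , q₅) ∷ tail | refl
    with i , j , i<j , alike ← Fin.pigeonhole (s≤s (s≤s (s≤s (s≤s (s≤s z≤n))))) (List.lookup (q₁ ∷ q₂ ∷ q₃ ∷ q₄ ∷ q₅ ∷ []))
    with ys , pair ← pick-two (q₁ ∷ q₂ ∷ q₃ ∷ q₄ ∷ q₅ ∷ []) i<j =
    _ , map (p ,_) ys ++ tail , ↭-trans row↭ (++⁺ʳ tail (map⁺ (p ,_)
      (subst (λ q → _ ↭ List.lookup (q₁ ∷ q₂ ∷ q₃ ∷ q₄ ∷ q₅ ∷ []) i ∷ q ∷ ys) (sym alike) pair)))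

  split-twice : ∀ {x : Placed K} row {row′} → row ↭ x ∷ x ∷ row′ →
    ∃[ r₁ ] ∃[ r₂ ] ∃[ r₃ ] row ≡ r₁ ++ x ∷ r₂ ++ x ∷ r₃
  split-twice {x} row perm
    with l₁ , l₂ , refl ← ∈-∃++ (∈-resp-↭ (↭-sym perm) (here refl))
    with ∈-++⁻ l₁ (∈-resp-↭ (↭-sym (drop-∷ (↭-trans (↭-sym (shift x l₁ l₂)) perm))) (here refl))
  ... | inj₁ x∈l₁ with r₁ , r₂ , refl ← ∈-∃++ x∈l₁ = r₁ , r₂ , l₂ , ++-assoc r₁ (x ∷ r₂) (x ∷ l₂)
  ... | inj₂ x∈l₂ with r₂ , r₃ , refl ← ∈-∃++ x∈l₂ = l₁ , r₂ , r₃ , refl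

  -- The segment between two equal pieces x leads from the right end of x
  -- to its left end, so both copies of x can be dropped if it is reversed.
  remove-two : ∀ p (ps : List (Piece K)) → Arrangeable (p ∷ p ∷ p ∷ p ∷ p ∷ ps) → Arrangeable (p ∷ p ∷ p ∷ ps)
  remove-two p ps arr
    with a , b , row , w , perm ← Arrangeable⇒Walk arr
    with q , _ , row↭ ← turned-alike row perm
    with r₁ , r₂ , r₃ , refl ← split-twice row row↭
    with _ , u₁ , (x ∷ (refl , w₂)) ← splitʷ r₁ w
    with _ , u₂ , (_ ∷ (refl , u₃)) ← splitʷ r₂ w₂ =
    r₁ ++ mirror r₂ ++ r₃ , Walk⇒Linked (u₁ ++ʷ (mirrorʷ u₂ ++ʷ u₃)) ,
    -- Both dropped copies are put in front again, so that `perm`, which concerns the whole row,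
    -- applies; then they are cancelled.
    drop-∷ (drop-∷ (begin
      p ∷ p ∷ pieces (r₁ ++ mirror r₂ ++ r₃)          ≡⟨ cong (λ l → p ∷ p ∷ l) (trans (map-++ proj₁ r₁ _) (cong (pieces r₁ ++_) (map-++ proj₁ (mirror r₂) r₃))) ⟩
      p ∷ p ∷ pieces r₁ ++ pieces (mirror r₂) ++ pieces r₃ ↭⟨ ↭-prep p (↭-prep p (++⁺ˡ (pieces r₁) (++⁺ʳ (pieces r₃) (pieces-mirror r₂)))) ⟩
      p ∷ p ∷ pieces r₁ ++ pieces r₂ ++ pieces r₃     ≡⟨ cong (λ l → p ∷ p ∷ l) (trans (map-++ proj₁ r₁ _) (cong (pieces r₁ ++_) (map-++ proj₁ r₂ r₃))) ⟨
      pieces (x ∷ x ∷ r₁ ++ r₂ ++ r₃)                 ≡⟨ cong (λ l → p ∷ p ∷ pieces l) (++-assoc r₁ r₂ r₃) ⟨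
      pieces (x ∷ x ∷ (r₁ ++ r₂) ++ r₃)               ↭⟨ map⁺ proj₁ (↭-prep x (shift x (r₁ ++ r₂) r₃)) ⟨
      pieces (x ∷ (r₁ ++ r₂) ++ x ∷ r₃)               ≡⟨ cong (λ l → p ∷ pieces l) (++-assoc r₁ r₂ (x ∷ r₃)) ⟩
      pieces (x ∷ r₁ ++ r₂ ++ x ∷ r₃)                 ↭⟨ map⁺ proj₁ (shift x r₁ (r₂ ++ x ∷ r₃)) ⟨
      pieces (r₁ ++ x ∷ r₂ ++ x ∷ r₃)                 ↭⟨ perm ⟩
      p ∷ p ∷ p ∷ p ∷ p ∷ ps                          ∎))
    where open PermutationReasoning

-- Multiplicities and the number of pieces in the kernel

module Counting {A : Set} (_≟_ : DecidableEquality A) where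

  count : A → List A → ℕ
  count x xs = length (filter (x ≟_) xs)

  count-↭ : ∀ x {xs ys} → xs ↭ ys → count x xs ≡ count x ys
  count-↭ x = ↭-length ∘ filter-↭ (x ≟_)

  count-++ : ∀ x xs ys → count x (xs ++ ys) ≡ count x xs + count x ys
  count-++ x xs ys = trans (cong length (filter-++ (x ≟_) xs ys)) (length-++ (filter (x ≟_) xs))

  count-all : ∀ {x xs} → All (x ≡_) xs → count x xs ≡ length xs
  count-all = cong length ∘ filter-all (_ ≟_)

  count-none : ∀ {x xs} → All (x ≢_) xs → count x xs ≡ 0
  count-none = cong length ∘ filter-none (_ ≟_)

  count-≤ʳ : ∀ x xs ys → count x ys ≤ count x (xs ++ ys)
  count-≤ʳ x xs ys rewrite count-++ x xs ys = m≤n+m _ _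

  separate : ∀ x xs → ∃[ ys ] ∃[ zs ] All (x ≡_) ys × All (x ≢_) zs × ys ++ zs ↭ xs
  separate x []       = [] , [] , [] , [] , ↭-refl
  separate x (y ∷ xs) with x ≟ y | separate x xs
  ... | yes x≡y | ys , zs , all-ys , all-zs , perm = y ∷ ys , zs , x≡y ∷ all-ys , all-zs , ↭-prep y perm
  ... | no  x≢y | ys , zs , all-ys , all-zs , perm =
    ys , y ∷ zs , all-ys , x≢y ∷ all-zs , ↭-trans (shift y ys zs) (↭-prep y perm)

  -- Splitting off all copies of `e` removes at most `c` entries and leaves a list that avoids `e`,
  -- hence has its members in the shorter list.
  length-≤ : ∀ c es xs → (∀ {x} → x ∈ xs → x ∈ es) → (∀ x → count x xs ≤ c) → length xs ≤ length es * c
  length-≤ c []       []       xs⊆es count≤c = z≤n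
  length-≤ c []       (x ∷ xs) xs⊆es count≤c with () ← xs⊆es (here refl)
  length-≤ c (e ∷ es) xs       xs⊆es count≤c with ys , zs , all-ys , all-zs , perm ← separate e xs = begin
    length xs              ≡⟨ ↭-length perm ⟨
    length (ys ++ zs)      ≡⟨ length-++ ys ⟩
    length ys + length zs  ≤⟨ +-mono-≤ ys≤c (length-≤ c es zs zs⊆es
                               λ x → ≤-trans (count-≤ʳ x ys zs) (≤-trans (≤-reflexive (count-↭ x perm)) (count≤c x))) ⟩
    c + length es * c      ∎
    where
    open ≤-Reasoning
    ys≤c : length ys ≤ c
    ys≤c = begin
      length ys                ≡⟨ count-all all-ys ⟨
      count e ys               ≤⟨ m≤m+n _ _ ⟩
      count e ys + count e zs  ≡⟨ count-++ e ys zs ⟨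
      count e (ys ++ zs)       ≡⟨ count-↭ e perm ⟩
      count e xs               ≤⟨ count≤c e ⟩
      c                        ∎
    zs⊆es : ∀ {x} → x ∈ zs → x ∈ es
    zs⊆es x∈zs with xs⊆es (∈-resp-↭ perm (∈-++⁺ʳ ys x∈zs))
    ... | here refl  = contradiction refl (All.lookup all-zs x∈zs)
    ... | there x∈es = x∈es

length-cartesianProductWith : ∀ {A B C : Set} (f : A → B → C) xs {ys m n} →
  length xs ≡ m → length ys ≡ n → length (cartesianProductWith f xs ys) ≡ m * n
length-cartesianProductWith f []            refl eq = refl
length-cartesianProductWith f (x ∷ xs) {ys} refl eq = trans (length-++ (map (f x) ys))
  (cong₂ _+_ (trans (length-map (f x) ys) eq) (length-cartesianProductWith f xs refl eq))

module _ {K : ℕ} where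

  open Counting (_≟ₚ_ {K})

  sidesRT : List (Fin K → Fin K → Piece K)
  sidesRT = cartesianProductWith piece (allFin K) (allFin K)

  sidesRTL : List (Fin K → Piece K)
  sidesRTL = cartesianProductWith (λ f l → f l) sidesRT (allFin K)

  allPieces : List (Piece K)
  allPieces = cartesianProductWith (λ f b → f b) sidesRTL (allFin K)

  ∈-allPieces : ∀ (p : Piece K) → p ∈ allPieces
  ∈-allPieces (piece r t l b) =
    ∈-cartesianProductWith⁺ (λ f b → f b)
      (∈-cartesianProductWith⁺ (λ f l → f l)
        (∈-cartesianProductWith⁺ piece (∈-allFin r) (∈-allFin t)) (∈-allFin l)) (∈-allFin b)

  length-allPieces : length allPieces ≡ K * K * K * K
  length-allPieces =
    length-cartesianProductWith (λ f b → f b) sidesRTL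
      (length-cartesianProductWith (λ f l → f l) sidesRT
        (length-cartesianProductWith piece (allFin K) length-allFin length-allFin) length-allFin) length-allFin
    where
    length-allFin : length (allFin K) ≡ K
    length-allFin = length-tabulate (λ i → i)

  Capped : List (Piece K) → Set
  Capped kernel = ∀ p → count p kernel ≤ 4

  Capped⇒length≤ : ∀ {kernel} → Capped kernel → length kernel ≤ K * K * K * K * 4
  Capped⇒length≤ {kernel} capped = subst (λ n → length kernel ≤ n * 4) length-allPieces
    (length-≤ 4 allPieces kernel (λ {p} _ → ∈-allPieces p) capped)

  -- Correctness of the kernelization

  sieve-correct : ∀ (p : Piece K) kernel → let same , others = foldl (sieve p) ([] , []) kernel in
    All (p ≡_) same × All (p ≢_) others × same ++ others ↭ kernel
  sieve-correct p kernel =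
    let all-same , all-others , perm = go kernel ([] , []) [] []
    in all-same , all-others , ↭-trans perm (↭-reflexive (++-identityʳ kernel))
    where
    go : ∀ xs acc → All (p ≡_) (proj₁ acc) → All (p ≢_) (proj₂ acc) →
         let same , others = foldl (sieve p) acc xs in
         All (p ≡_) same × All (p ≢_) others × same ++ others ↭ xs ++ proj₁ acc ++ proj₂ acc
    go []       acc             all-same all-others = all-same , all-others , ↭-refl
    go (x ∷ xs) (same , others) all-same all-others with x ≟ₚ p
    ... | yes x≡p with as , ao , perm ← go xs (x ∷ same , others) (sym x≡p ∷ all-same) all-others =
      as , ao , ↭-trans perm (shift x xs (same ++ others))
    ... | no x≢p with as , ao , perm ← go xs (same , x ∷ others) all-same (x≢p ∘ sym ∷ all-others) =
      as , ao , ↭-trans perm (↭-trans (++⁺ˡ xs (shift x same others)) (shift x xs (same ++ others)))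

  -- What remains of `add` once the sieve is forgotten. In the second case the kernel has exactly
  -- four copies of `p`, and the added one is the fifth.
  data Added (p : Piece K) (kernel : List (Piece K)) : List (Piece K) → Set where
    appended : count p kernel ≤ 3 → Added p kernel (p ∷ kernel)
    reduced  : ∀ {others} → All (p ≢_) others → p ∷ p ∷ p ∷ p ∷ others ↭ kernel →
               Added p kernel (p ∷ p ∷ p ∷ others)

  restock-correct : ∀ {p kernel} → Capped kernel → ∀ same {others} →
    All (p ≡_) same → All (p ≢_) others → same ++ others ↭ kernel →
    Added p kernel (restock p kernel (same , others))
  restock-correct {p} {kernel} capped same₀ {others} all-same₀ all-others perm₀ =
    go same₀ all-same₀ perm₀ count-same
    where
    count-same : count p kernel ≡ length same₀
    count-same = begin
      count p kernel                  ≡⟨ count-↭ p perm₀ ⟨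
      count p (same₀ ++ others)       ≡⟨ count-++ p same₀ others ⟩
      count p same₀ + count p others  ≡⟨ cong₂ _+_ (count-all all-same₀) (count-none all-others) ⟩
      length same₀ + 0                ≡⟨ +-identityʳ _ ⟩
      length same₀                    ∎
      where open ≡-Reasoning
    go : ∀ same → All (p ≡_) same → same ++ others ↭ kernel → count p kernel ≡ length same →
         Added p kernel (restock p kernel (same , others))
    go []                 _ _ eq = appended (≤-trans (≤-reflexive eq) z≤n)
    go (_ ∷ [])           _ _ eq = appended (≤-trans (≤-reflexive eq) (s≤s z≤n))
    go (_ ∷ _ ∷ [])       _ _ eq = appended (≤-trans (≤-reflexive eq) (s≤s (s≤s z≤n)))
    go (_ ∷ _ ∷ _ ∷ [])   _ _ eq = appended (≤-reflexive eq)
    go (_ ∷ _ ∷ _ ∷ _ ∷ []) (refl ∷ refl ∷ refl ∷ refl ∷ []) perm _ = reduced all-others perm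
    go (_ ∷ _ ∷ _ ∷ _ ∷ _ ∷ _) _ _ eq =
      contradiction (subst (_≤ 4) eq (capped p)) λ { (s≤s (s≤s (s≤s (s≤s ())))) }

  add-correct : ∀ (p : Piece K) {kernel} → Capped kernel → Added p kernel (add p kernel)
  add-correct p {kernel} capped =
    let all-same , all-others , perm = sieve-correct p kernel
    in restock-correct {kernel = kernel} capped _ all-same all-others perm

  added-capped : ∀ {p kernel kernel′} → Capped kernel → Added p kernel kernel′ → Capped kernel′
  added-capped {p} {kernel} capped (appended ≤3) q rewrite count-++ q (p ∷ []) kernel with q ≟ₚ p
  ... | yes refl = s≤s ≤3
  ... | no q≢p   = capped q
  -- Five copies replaced by three amount to the old kernel with one copy of `p` missing.
  added-capped {p} {kernel} capped (reduced {others} _ perm) q = begin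
    count q (p ∷ p ∷ p ∷ others)     ≤⟨ count-≤ʳ q (p ∷ []) (p ∷ p ∷ p ∷ others) ⟩
    count q (p ∷ p ∷ p ∷ p ∷ others) ≡⟨ count-↭ q perm ⟩
    count q kernel                   ≤⟨ capped q ⟩
    4                                ∎
    where open ≤-Reasoning

  add-capped : ∀ (p : Piece K) {kernel} → Capped kernel → Capped (add p kernel)
  add-capped p {kernel} capped = added-capped capped (add-correct p {kernel} capped)

  -- The pieces still to come are carried along, because a row has to be rearranged as a whole.
  added-arrangeable : ∀ {p kernel kernel′} pending → Added p kernel kernel′ →
    Arrangeable (kernel′ ++ pending) ⇔ Arrangeable (kernel ++ p ∷ pending)
  added-arrangeable {p} {kernel} pending (appended _) =
    mk⇔ (Arrangeable-resp-↭ (↭-sym (shift p kernel pending)))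
        (Arrangeable-resp-↭ (shift p kernel pending))
  added-arrangeable {p} {kernel} pending (reduced {others} _ perm) = mk⇔
    (Arrangeable-resp-↭ five ∘ insert-two p (p ∷ p ∷ others ++ pending))
    (remove-two p (others ++ pending) ∘ Arrangeable-resp-↭ (↭-sym five))
    where
    five : p ∷ p ∷ p ∷ p ∷ p ∷ others ++ pending ↭ kernel ++ p ∷ pending
    five = ↭-trans (↭-prep p (++⁺ʳ pending perm)) (↭-sym (shift p kernel pending))

  foldl-add-arrangeable : ∀ pending {kernel} → Capped kernel →
    Arrangeable (foldl (λ kernel p → add p kernel) kernel pending) ⇔ Arrangeable (kernel ++ pending)
  foldl-add-arrangeable []            {kernel} capped =
    subst (λ l → Arrangeable kernel ⇔ Arrangeable l) (sym (++-identityʳ kernel)) (⇔-id _)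
  foldl-add-arrangeable (p ∷ pending) {kernel} capped =
    added-arrangeable pending (add-correct p {kernel} capped) ⇔-∘
    foldl-add-arrangeable pending (add-capped p {kernel} capped)

  kernelize-arrangeable : ∀ (ps : List (Piece K)) → Arrangeable (kernelize ps) ⇔ Arrangeable ps
  kernelize-arrangeable ps = foldl-add-arrangeable ps {[]} (λ _ → z≤n)

-- Placements and rows

linked-tabulate : ∀ {A : Set} {R : A → A → Set} {n} (f : Fin n → A) →
  (∀ i j → toℕ j ≡ suc (toℕ i) → R (f i) (f j)) → Linked R (List.tabulate f)
linked-tabulate {n = zero}        f R-f = []
linked-tabulate {n = suc zero}    f R-f = [-]
linked-tabulate {n = suc (suc n)} f R-f =
  R-f zero (suc zero) refl ∷ linked-tabulate (f ∘ suc) (λ i j eq → R-f (suc i) (suc j) (cong suc eq))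

linked-lookup : ∀ {A : Set} {R : A → A → Set} {xs} → Linked R xs →
  ∀ i j → toℕ j ≡ suc (toℕ i) → R (lookup (fromList xs) i) (lookup (fromList xs) j)
linked-lookup (r ∷ linked) zero    (suc zero) eq = r
linked-lookup (r ∷ linked) (suc i) (suc j)    eq = linked-lookup linked i j (suc-injective eq)
linked-lookup [-]          zero    (suc ())   eq

toList-tabulate-lookup : ∀ {A : Set} {n} (xs : Vec A n) → List.tabulate (lookup xs) ≡ toList xs
toList-tabulate-lookup []       = refl
toList-tabulate-lookup (x ∷ xs) = cong (x ∷_) (toList-tabulate-lookup xs)

-- Both lists are free of duplicates and contain all of `Fin n`.
tabulate-permutation : ∀ {n} (π : Permutation′ n) → List.tabulate (π ⟨$⟩ʳ_) ↭ allFin n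
tabulate-permutation {n} π = ∼bag⇒↭ (unique∧set⇒bag
  (tabulate⁺ (Injection.injective (↔⇒↣ π))) (allFin⁺ n)
  λ {i} → mk⇔ (λ _ → ∈-allFin i)
              (λ _ → subst (_∈ List.tabulate (π ⟨$⟩ʳ_)) (Perm.inverseʳ π) (∈-tabulate⁺ (π ⟨$⟩ˡ i))))

lookup-toList : ∀ {A : Set} {n} (xs : Vec A n) i .(eq : n ≡ length (toList xs)) →
  List.lookup (toList xs) (Fin.cast eq i) ≡ lookup xs i
lookup-toList (x ∷ xs) zero    eq = refl
lookup-toList (x ∷ xs) (suc i) eq = lookup-toList xs i (suc-injective eq)

↭⇒permutation : ∀ {A : Set} {n} (xs ys : Vec A n) → toList xs ↭ toList ys →
  Σ (Permutation′ n) λ π → ∀ i → lookup xs i ≡ lookup ys (π ⟨$⟩ʳ i)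
↭⇒permutation {A} {n} xs ys perm = cast-id n≡xs ∘ₚ indices ∘ₚ cast-id ys≡n , λ i → begin
  lookup xs i                                        ≡⟨ lookup-toList xs i n≡xs ⟨
  List.lookup (toList xs) (Fin.cast n≡xs i)          ≡⟨ onIndices-lookup (setoid A) (↭⇒↭ₛ perm) _ ⟩
  List.lookup (toList ys) (indices ⟨$⟩ʳ Fin.cast n≡xs i) ≡⟨ cong (List.lookup (toList ys)) (Fin.cast-involutive (sym ys≡n) ys≡n _) ⟨
  List.lookup (toList ys) (Fin.cast (sym ys≡n) (Fin.cast ys≡n (indices ⟨$⟩ʳ Fin.cast n≡xs i)))
                                                     ≡⟨ lookup-toList ys _ (sym ys≡n) ⟩
  lookup ys (Fin.cast ys≡n (indices ⟨$⟩ʳ Fin.cast n≡xs i)) ∎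
  where
  open ≡-Reasoning
  n≡xs : n ≡ length (toList xs)
  n≡xs = sym (length-toList xs)
  ys≡n : length (toList ys) ≡ n
  ys≡n = length-toList ys
  indices : Permutation (length (toList xs)) (length (toList ys))
  indices = onIndices (↭⇒↭ₛ perm)

placeable⇒arrangeable : ∀ {K M} (ps : Vec (Piece K) M) →
  Placeable (pieceSet K M ps) → Arrangeable (toList ps)
placeable⇒arrangeable {K} {M} ps (π , ρ , touching) =
  List.tabulate row , linked-tabulate row touching , perm
  where
  row : Fin M → Placed K
  row i = lookup ps (π ⟨$⟩ʳ i) , ρ i
  perm : List.map proj₁ (List.tabulate row) ↭ toList ps
  perm = begin
    List.map proj₁ (List.tabulate row)              ≡⟨ map-tabulate row proj₁ ⟩
    List.tabulate (lookup ps ∘ (π ⟨$⟩ʳ_))           ≡⟨ map-tabulate (π ⟨$⟩ʳ_) (lookup ps) ⟨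
    List.map (lookup ps) (List.tabulate (π ⟨$⟩ʳ_))  ↭⟨ map⁺ (lookup ps) (tabulate-permutation π) ⟩
    List.map (lookup ps) (allFin M)                 ≡⟨ map-tabulate id (lookup ps) ⟩
    List.tabulate (lookup ps)                       ≡⟨ toList-tabulate-lookup ps ⟩
    toList ps                                       ∎
    where open PermutationReasoning

arrangeable⇒placeable : ∀ {K M} (ps : Vec (Piece K) M) →
  Arrangeable (toList ps) → Placeable (pieceSet K M ps)
arrangeable⇒placeable {K} {M} ps (row , linked , perm)
  -- Identifies M with the length of the row, so that `fromList row` can be indexed by cells.
  with refl ← trans (sym (length-map proj₁ row)) (trans (↭-length perm) (length-toList ps)) =
  π , (λ i → proj₂ (placed i)) , λ i j eq →
    subst₂ (λ p q → right (rotate (proj₂ (placed i)) p) ≡ left (rotate (proj₂ (placed j)) q))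
      (same-piece i) (same-piece j) (linked-lookup linked i j eq)
  where
  placed : Fin M → Placed K
  placed = lookup (fromList row)
  matching = ↭⇒permutation (Vec.map proj₁ (fromList row)) ps
    (subst (_↭ toList ps)
      (sym (trans (toList-map proj₁ (fromList row)) (cong (List.map proj₁) (toList∘fromList row)))) perm)
  π = proj₁ matching
  same-piece : ∀ i → proj₁ (placed i) ≡ lookup ps (π ⟨$⟩ʳ i)
  same-piece i = trans (sym (lookup-map i proj₁ (fromList row))) (proj₂ matching i)

-- Sizes of encodings

-- A digit adds at most 4 to the size and at least 1 to the number. A logarithmic bound would be
-- closer, but any bound in K will do.
size-bitsTree : ∀ n → size (bitsTree n) ≤ 1 + 4 * ℕᵇ.toℕ n
size-bitsTree ℕᵇ.zero  = ≤-refl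
size-bitsTree 2[1+ n ] = begin
  2 + size (bitsTree n)              ≤⟨ +-mono-≤ {2} {4} (s≤s (s≤s z≤n)) (size-bitsTree n) ⟩
  5 + 4 * ℕᵇ.toℕ n                   ≡⟨ cong suc (*-suc 4 (ℕᵇ.toℕ n)) ⟨
  1 + 4 * suc (ℕᵇ.toℕ n)             ≤⟨ s≤s (*-monoʳ-≤ 4 (m≤m+n (suc (ℕᵇ.toℕ n)) _)) ⟩
  1 + 4 * (2 * suc (ℕᵇ.toℕ n))       ∎
  where open ≤-Reasoning
size-bitsTree 1+[2 n ] = begin
  4 + size (bitsTree n)              ≤⟨ +-monoʳ-≤ 4 (size-bitsTree n) ⟩
  5 + 4 * ℕᵇ.toℕ n                   ≡⟨ cong suc (*-suc 4 (ℕᵇ.toℕ n)) ⟨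
  1 + 4 * suc (ℕᵇ.toℕ n)             ≤⟨ s≤s (*-monoʳ-≤ 4 (s≤s (m≤m+n (ℕᵇ.toℕ n) _))) ⟩
  1 + 4 * suc (2 * ℕᵇ.toℕ n)         ∎
  where open ≤-Reasoning

colorSize pieceSize kernelSize : ℕ → ℕ
colorSize K  = 1 + 4 * K
pieceSize K  = 1 + (colorSize K + (1 + (colorSize K + (1 + (colorSize K + (1 + (colorSize K + 1)))))))
kernelSize K = 1 + K * K * K * K * 4 * (1 + pieceSize K)

size-colorTree : ∀ {K} (c : Fin K) → size (colorTree c) ≤ colorSize K
size-colorTree {K} c = begin
  size (colorTree c)                  ≤⟨ size-bitsTree (fromℕ (toℕ c)) ⟩
  1 + 4 * ℕᵇ.toℕ (fromℕ (toℕ c))      ≡⟨ cong (λ n → 1 + 4 * n) (toℕ-fromℕ (toℕ c)) ⟩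
  1 + 4 * toℕ c                       ≤⟨ s≤s (*-monoʳ-≤ 4 (<⇒≤ (Fin.toℕ<n c))) ⟩
  1 + 4 * K                           ∎
  where open ≤-Reasoning

size-pieceTree : ∀ {K} (p : Piece K) → size (pieceTree p) ≤ pieceSize K
size-pieceTree (piece r t l b) =
  s≤s (+-mono-≤ (size-colorTree r) (s≤s (+-mono-≤ (size-colorTree t)
  (s≤s (+-mono-≤ (size-colorTree l) (s≤s (+-mono-≤ (size-colorTree b) ≤-refl)))))))

size-piecesTree : ∀ {K} (ps : List (Piece K)) → size (piecesTree ps) ≤ 1 + length ps * (1 + pieceSize K)
size-piecesTree     []       = ≤-refl
size-piecesTree {K} (p ∷ ps) = s≤s (begin
  size (pieceTree p) + size (piecesTree ps)               ≤⟨ +-mono-≤ (size-pieceTree p) (size-piecesTree ps) ⟩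
  pieceSize K + (1 + length ps * (1 + pieceSize K))       ≡⟨ +-suc (pieceSize K) (length ps * (1 + pieceSize K)) ⟩
  (1 + pieceSize K) + length ps * (1 + pieceSize K)       ∎)
  where open ≤-Reasoning

size-kernel : ∀ {K} {kernel : List (Piece K)} → Capped kernel → size (piecesTree kernel) ≤ kernelSize K
size-kernel {kernel = kernel} capped =
  ≤-trans (size-piecesTree kernel) (s≤s (*-monoˡ-≤ _ (Capped⇒length≤ {kernel = kernel} capped)))

length<size : ∀ {K} (ps : List (Piece K)) → length ps < size (piecesTree ps)
length<size []       = ≤-refl
length<size (p ∷ ps) = s≤s (≤-trans (length<size ps) (m≤n+m _ _))

suc-dominated : ∀ {f} → Dominated f → Dominated (suc ∘ f)
suc-dominated f-dom = const-dominated 1 +-dominated f-dom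

colorSize-dominated : Dominated colorSize
colorSize-dominated = suc-dominated (const-dominated 4 *-dominated id-dominated)

pieceSize-dominated : Dominated pieceSize
pieceSize-dominated =
  suc-dominated (colorSize-dominated +-dominated suc-dominated (colorSize-dominated +-dominated
  suc-dominated (colorSize-dominated +-dominated suc-dominated (colorSize-dominated +-dominated
  const-dominated 1))))

kernelSize-dominated : Dominated kernelSize
kernelSize-dominated = suc-dominated
  (id-dominated *-dominated id-dominated *-dominated id-dominated *-dominated id-dominated
   *-dominated const-dominated 4 *-dominated suc-dominated pieceSize-dominated)

-- Running time

addGrowth exhaustsGrowth : Growth
addGrowth      = proj₁ (bounded addFun)
exhaustsGrowth = proj₁ (bounded exhaustsFun)

addTime exhaustsTime deciderTime : ℕ → ℕ
addTime K      = value addGrowth (1 + (pieceSize K + kernelSize K))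
exhaustsTime K = value exhaustsGrowth (kernelSize K)
deciderTime K  = 100 + (addTime K + exhaustsTime K)

opaque

  deciderTime-dominated : Dominated deciderTime
  deciderTime-dominated = const-dominated 100 +-dominated
    (value-dominated addGrowth ∘-dominated suc-dominated (pieceSize-dominated +-dominated kernelSize-dominated)
     +-dominated value-dominated exhaustsGrowth ∘-dominated kernelSize-dominated)

growth : Growth
growth = proj₁ deciderTime-dominated

time-addFun : ∀ {K} (p : Piece K) {kernel : List (Piece K)} → Capped kernel →
  time addFun (pieceTree p ∙ piecesTree kernel) ≤ addTime K
time-addFun p {kernel} capped = ≤-trans (proj₂ (proj₂ (bounded addFun) (pieceTree p ∙ piecesTree kernel)))
  (monotone addGrowth (s≤s (+-mono-≤ (size-pieceTree p) (size-kernel {kernel = kernel} capped))))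

time-exhaustsFun : ∀ {K} {kernel : List (Piece K)} → Capped kernel →
  time exhaustsFun (piecesTree kernel) ≤ exhaustsTime K
time-exhaustsFun {kernel = kernel} capped =
  ≤-trans (proj₂ (proj₂ (bounded exhaustsFun) (piecesTree kernel)))
          (monotone exhaustsGrowth (size-kernel {kernel = kernel} capped))

-- The bound from `Loop` compounds the growth of the accumulator. An invariant that limits every
-- iteration by the same `C` makes the time linear in the number of entries.
timeFold-listOf : ∀ {A B : Set} (encA : A → Tree) (encB : B → Tree) {F t} {f : B → A → B} →
  (Inv : B → Set) → ∀ C →
  (∀ x b → F (encA x) (encB b) ≡ encB (f b x)) → (∀ x b → Inv b → Inv (f b x)) →
  (∀ x b → Inv b → t (encA x) (encB b) ≤ C) →
  ∀ xs b → Inv b → timeFold F t (listOf encA xs) (encB b) ≤ 3 + length xs * (22 + C)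
timeFold-listOf encA encB                 Inv C F≡f f-inv t≤C []       b b-inv = ≤-refl
timeFold-listOf encA encB {F} {t} {f} Inv C F≡f f-inv t≤C (x ∷ xs) b b-inv = begin
  3 + ((8 + (7 + (t (encA x) (encB b) + 4))) + rest (F (encA x) (encB b)))
    ≡⟨ cong (λ a → 3 + ((8 + (7 + (t (encA x) (encB b) + 4))) + rest a)) (F≡f x b) ⟩
  3 + ((8 + (7 + (t (encA x) (encB b) + 4))) + rest (encB (f b x)))
    ≤⟨ +-monoʳ-≤ 3 (+-mono-≤ (+-monoʳ-≤ 15 (+-monoˡ-≤ 4 (t≤C x b b-inv)))
        (timeFold-listOf encA encB Inv C F≡f f-inv t≤C xs (f b x) (f-inv x b b-inv))) ⟩
  3 + ((8 + (7 + (C + 4))) + (3 + length xs * (22 + C)))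
    ≡⟨ regroup C (length xs * (22 + C)) ⟩
  3 + ((22 + C) + length xs * (22 + C)) ∎
  where
  open ≤-Reasoning
  rest : Tree → ℕ
  rest = timeFold F t (listOf encA xs)
  regroup : ∀ c y → 3 + ((8 + (7 + (c + 4))) + (3 + y)) ≡ 3 + ((22 + c) + y)
  regroup = solve-∀

empty-capped : ∀ {K} → Capped {K} []
empty-capped _ = z≤n

kernelize-capped : ∀ {K} (ps : List (Piece K)) {kernel : List (Piece K)} → Capped kernel →
  Capped (List.foldl (λ kernel p → add p kernel) kernel ps)
kernelize-capped []                capped = capped
kernelize-capped (p ∷ ps) {kernel} capped = kernelize-capped ps {add p kernel} (add-capped p {kernel} capped)

time-kernelizeFun : ∀ {K} (ps : List (Piece K)) k →
  time kernelizeFun (k ∙ piecesTree ps) ≤ 5 + (4 + (2 + (3 + length ps * (59 + addTime K) + 3)))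
time-kernelizeFun {K} ps k = +-monoʳ-≤ 11 (+-monoˡ-≤ 3 (timeFold-listOf pieceTree piecesTree
  {f = λ kernel p → add p kernel} Capped (37 + addTime K) addFun-correct (λ p kernel → add-capped p {kernel}) step ps [] empty-capped))
  where
  step : ∀ (p : Piece K) kernel → Capped kernel →
    25 + (4 + (2 + (time addFun (pieceTree p ∙ piecesTree kernel) + 6))) ≤ 37 + addTime K
  step p kernel capped = begin
    31 + (time addFun (pieceTree p ∙ piecesTree kernel) + 6) ≤⟨ +-monoʳ-≤ 31 (+-monoˡ-≤ 6 (time-addFun p {kernel} capped)) ⟩
    31 + (addTime K + 6)                                     ≡⟨ cong (31 +_) (+-comm (addTime K) 6) ⟩
    37 + addTime K                                           ∎
    where open ≤-Reasoning

time-decider : ∀ {K} (ps : List (Piece K)) k →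
  2 + time decider (k ∙ piecesTree ps) ≤ deciderTime K * (1 + length ps)
time-decider {K} ps k = begin
  2 + time decider (k ∙ piecesTree ps)
    ≤⟨ +-monoʳ-≤ 2 (+-mono-≤ (time-kernelizeFun ps k) (+-monoʳ-≤ 6 (+-monoˡ-≤ 6 search≤))) ⟩
  2 + (5 + (4 + (2 + (3 + M * (59 + addTime K) + 3))) + (6 + (exhaustsTime K + 6)))
    ≤⟨ m≤m+n _ (69 + addTime K + M * (41 + exhaustsTime K)) ⟩
  2 + (5 + (4 + (2 + (3 + M * (59 + addTime K) + 3))) + (6 + (exhaustsTime K + 6)))
    + (69 + addTime K + M * (41 + exhaustsTime K))
    ≡⟨ collected M (addTime K) (exhaustsTime K) ⟩
  deciderTime K * (1 + M) ∎
  where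
  open ≤-Reasoning
  M = length ps
  search≤ : time exhaustsFun (⟦ kernelizeFun ⟧ (k ∙ piecesTree ps)) ≤ exhaustsTime K
  search≤ = subst (λ x → time exhaustsFun x ≤ exhaustsTime K) (sym (kernelizeFun-correct ps k))
    (time-exhaustsFun {kernel = kernelize ps} (kernelize-capped ps {[]} empty-capped))
  collected : ∀ m a e → 2 + (5 + (4 + (2 + (3 + m * (59 + a) + 3))) + (6 + (e + 6))) + (69 + a + m * (41 + e)) ≡
                        (100 + (a + e)) * (1 + m)
  collected = solve-∀

kernel-decides : ∀ {K M} (ps : Vec (Piece K) M) →
  Reflects (Placeable (pieceSet K M ps)) (exhausts (kernelize (toList ps)))
kernel-decides ps with exhausts (kernelize (toList ps)) in eq
... | true  = ofʸ (arrangeable⇒placeable ps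
                (Equivalence.to (kernelize-arrangeable (toList ps))
                  (exhausts-sound (kernelize (toList ps)) eq)))
... | false = ofⁿ λ placeable → case trans (sym eq)
                (exhausts-complete (kernelize (toList ps))
                  (Equivalence.from (kernelize-arrangeable (toList ps)) (placeable⇒arrangeable ps placeable)))
                of λ ()

decider-within : ∀ K (ps : List (Piece K)) → let x = binaryTree K ∙ piecesTree ps in
  2 + time decider x ≤ value growth K * evalPoly (0 ∷ 1 ∷ []) (size x)
decider-within K ps = begin
  2 + time decider x                        ≤⟨ time-decider ps (binaryTree K) ⟩
  deciderTime K * (1 + length ps)           ≤⟨ *-mono-≤ (proj₂ deciderTime-dominated K) M<n ⟩
  value growth K * size x                   ≡⟨ cong (value growth K *_) (identity (size x)) ⟩
  value growth K * (0 + size x * (1 + size x * 0)) ∎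
  where
  open ≤-Reasoning
  x = binaryTree K ∙ piecesTree ps
  M<n : 1 + length ps ≤ size x
  M<n = ≤-trans (length<size ps) (m≤n⇒m≤1+n (m≤n+m _ (size (binaryTree K))))
  identity : ∀ n → n ≡ 0 + n * (1 + n * 0)
  identity = solve-∀

decider-decides : DecidesWithin singleRowSwapsRotations (toProgram decider)
  (λ x → value growth (PieceSet.K x) * evalPoly (0 ∷ 1 ∷ []) (size (pieceSetTree x)))
decider-decides x@(pieceSet K M ps) =
  exhausts (kernelize (toList ps)) , 2 + time decider (pieceSetTree x) ,
  runs decider (pieceSetTree x) (decider-correct (toList ps) (binaryTree K)) ,
  decider-within K (toList ps) ,
  kernel-decides ps

corollary4p2 : FixedParameterTractable singleRowSwapsRotations
corollary4p2 =
  value growth , 0 ∷ 1 ∷ [] , toProgram decider , value-computable growth , decider-decides
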